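{- Every graph $G$ has a $(\leq 3\cdot 2^{2|E(G)|-1})$-subdivision $S$ with $\phi(S)\le 14$.
   Context: An anagram is a word of the form $WP$ where $W$ is a non-empty word and $P$ is a permutation of $W$. A vertex colouring of a graph is anagram-free if the sequence of colours along every path of the graph is not an anagram. $\phi(G)$ is the minimum number of colours in an anagram-free colouring of $G$. A subdivision of $G$ is obtained by replacing each edge $uv$ by a path with endpoints $u,v$; internal vertices are division vertices. A $(\le k)$-subdivision is a subdivision in which every edge receives at most $k$ division vertices. -}

module Defs where

open import Data.Nat using (ℕ; zero; suc; _∸_)
open import Data.Fin using (Fin; toℕ)
open import Data.Product using (Σ; _×_; _,_; ∃; ∃-syntax)
open import Data.Sum using (_⊎_; inj₁; inj₂)
open import Data.List using (List; []; _∷_; _++_; map)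
open import Data.List.Relation.Unary.Linked using (Linked)
open import Data.List.Relation.Unary.Unique.Propositional using (Unique)
open import Data.List.Relation.Binary.Permutation.Propositional using (_↭_)
open import Relation.Binary.PropositionalEquality using (_≡_; _≢_)
open import Relation.Nullary using (¬_)

record SimpleGraph : Set where
  field
    n     : ℕ
    m     : ℕ
    edge  : Fin m → Fin n × Fin n
    loopless : ∀ i → Data.Product.proj₁ (edge i) ≢ Data.Product.proj₂ (edge i)
    distinctEdges : ∀ i j → (edge i ≡ edge j ⊎ edge i ≡ Data.Product.swap (edge j)) → i ≡ j

open SimpleGraph public

IsAnagram : {C : Set} → List C → Set
IsAnagram {C} w = ∃[ W ] ∃[ P ] (W ≢ []) × (P ↭ W) × (w ≡ W ++ P)

IsPath : {V : Set} → (V → V → Set) → List V → Set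
IsPath Adj ps = (ps ≢ []) × Unique ps × Linked Adj ps

AnagramFree : {V C : Set} → (V → V → Set) → (V → C) → Set
AnagramFree Adj c = ∀ ps → IsPath Adj ps → ¬ IsAnagram (map c ps)

PhiAtMost : {V : Set} → (V → V → Set) → ℕ → Set
PhiAtMost {V} Adj k = Σ (V → Fin k) (AnagramFree Adj)

-- The subdivision of G in which edge i receives sub i division vertices.
-- Vertices: original vertices, and division vertices (i , j), j < sub i.
-- Edge i = (u , v) is replaced by the path u, (i,0), (i,1), …, (i,sub i - 1), v.
SubV : (G : SimpleGraph) → (Fin (m G) → ℕ) → Set
SubV G sub = Fin (n G) ⊎ Σ (Fin (m G)) (λ i → Fin (sub i))

data SubArc (G : SimpleGraph) (sub : Fin (m G) → ℕ) : SubV G sub → SubV G sub → Set where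
  direct : ∀ i u v → edge G i ≡ (u , v) → sub i ≡ 0 → SubArc G sub (inj₁ u) (inj₁ v)
  first  : ∀ i u v (j : Fin (sub i)) → edge G i ≡ (u , v) → toℕ j ≡ 0 →
           SubArc G sub (inj₁ u) (inj₂ (i , j))
  inner  : ∀ i (j j' : Fin (sub i)) → toℕ j' ≡ suc (toℕ j) →
           SubArc G sub (inj₂ (i , j)) (inj₂ (i , j'))
  last   : ∀ i u v (j : Fin (sub i)) → edge G i ≡ (u , v) → toℕ j ≡ sub i ∸ 1 →
           SubArc G sub (inj₂ (i , j)) (inj₁ v)

SubAdj : (G : SimpleGraph) → (sub : Fin (m G) → ℕ) → SubV G sub → SubV G sub → Set
SubAdj G sub x y = SubArc G sub x y ⊎ SubArc G sub y x

{-# OPTIONS --safe #-}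
module Submission where

-- Edge i gets 8 · 2^i division vertices, cut into four segments of length 2 · 2^i.  In segment c every
-- other vertex has the marker colour c; the vertices in between spell an abelian-square-free word over
-- nine letters.  Original vertices share one further colour, giving 1 + 4 + 9 = 14.
--
-- Suppose a path is an anagram W P.  Its start, its middle and its end lie in at most three segments, so
-- some c is hit by none of them, and then each c-segment of an edge is contained in W, contained in P or
-- avoided by the path.  The c-segment of edge i has 2^i markers, so by uniqueness of binary expansions W
-- and P can have equally many c-markers only if they have none.  Deleting a c-marker from each edge leaves
-- disjoint stars around the original vertices, so the path has at most one original vertex; as W and P have
-- equally many, it has none.  Thus the path runs monotonically inside one edge, and forgetting the markers
-- leaves an abelian square.
--
-- The abelian-square-free word is the fixed point of a 6-uniform morphism σ with invertible incidence
-- matrix, handled as in Dekking's method: a linear functional vanishing mod 288 on all σ a takes, at the cut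
-- points inside the blocks, values without nontrivial three-term arithmetic progressions.  The three cut
-- points of an abelian square therefore sit at equivalent places of their blocks, and the square can be
-- moved to block boundaries and desubstituted to a shorter one.

open import Defs
open import Data.Nat using (ℕ; _≤_; _*_; _^_; _∸_)
open import Data.Fin using (Fin)
open import Data.Product using (Σ; _×_)
import Algebra.Properties.Semiring.Sum as Sum
open import Data.Bool using (Bool; true; false; if_then_else_)
open import Data.Empty using (⊥; ⊥-elim)
open import Data.Fin using (zero; suc; toℕ; fromℕ<; #_; splitAt; join)
import Data.Fin.Properties as Fin
open import Data.Fin.Properties using (toℕ<n; toℕ-injective; toℕ-fromℕ<; splitAt-join)
open import Data.Integer as ℤ using (ℤ; +_; -_; ∣_∣; 0ℤ; 1ℤ)
import Data.Integer.Properties as ℤ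
open import Data.Integer.Tactic.RingSolver using () renaming (solve-∀ to ℤ-solve-∀)
open import Data.List using (List; []; _∷_; _++_; map; length; filter; take; drop; tabulate; applyUpTo)
open import Data.List.Membership.Propositional using (_∈_; find; lose)
open import Data.List.Membership.Propositional.Properties
  using (∈-∃++; ∈-++⁺ˡ; ∈-++⁺ʳ; ∈-++⁻; ∈-applyUpTo⁺; ∈-filter⁺; ∈-filter⁻; ∈-map⁺; ∈-map⁻)
open import Data.List.Properties
  using (take-suc-tabulate; take++drop≡id; ≡-dec; length-++; length-map; length-tabulate; length-applyUpTo;
         map-++; map-∘; map-cong; ∷-injectiveˡ; ∷-injectiveʳ)
open import Data.List.Relation.Binary.Permutation.Propositional as ↭ using (_↭_; ↭-sym)
open import Data.List.Relation.Binary.Permutation.Propositional.Properties using (↭-length; filter-↭; ∈-resp-↭; map⁺)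
open import Data.List.Relation.Unary.All as All using ([]; _∷_)
import Data.List.Relation.Unary.All.Properties as All
open import Data.List.Relation.Unary.AllPairs as AllPairs using ([]; _∷_)
open import Data.List.Relation.Unary.Any using (here; there; any?)
open import Data.List.Relation.Unary.Linked as Linked using (Linked; []; [-]; _∷_)
import Data.List.Relation.Unary.Linked.Properties as Linked
open import Data.List.Relation.Unary.Unique.Propositional using (Unique)
import Data.List.Relation.Unary.Unique.Propositional.Properties as Unique
open import Data.Nat as ℕ using (zero; suc; ⌊_/2⌋; _/_; _%_; NonZero; z≤n; s≤s)
open import Data.Nat.Divisibility using (n∣m*n)
import Data.Nat.DivMod as ℕ
open import Data.Nat.Induction using (<-wellFounded)
import Data.Nat.Properties as ℕ
open import Data.Nat.Tactic.RingSolver using () renaming (solve-∀ to ℕ-solve-∀)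
open import Data.Product using (_,_; ∃-syntax; proj₁; proj₂)
open import Data.Sum using (_⊎_; inj₁; inj₂)
open import Data.Unit using (tt)
open import Data.Vec as Vec using (Vec; []; _∷_)
open import Function using (_∘_)
open import Induction.WellFounded using (Acc; acc)
open import Relation.Binary.Definitions using (tri<; tri≈; tri>)
open import Relation.Binary.PropositionalEquality
open import Relation.Nullary using (¬_; yes; no; does; Dec)
open import Relation.Nullary.Decidable using (toWitness; _×-dec_; _→-dec_; ¬?)
open import Relation.Unary using (Decidable)
open Sum ℤ.+-*-semiring using (sum; ∑-distrib-+; sum-cong-≗; sum-replicate-zero)

-- The abelian-square-free word

Letter : Set
Letter = Fin 9

-- The image of 0 begins with 0, so iterating `σ` from 0 converges to an infinite fixed point.
imageTable : Vec (Vec Letter 6) 9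
imageTable =
  (# 0 ∷ # 1 ∷ # 0 ∷ # 5 ∷ # 0 ∷ # 8 ∷ []) ∷
  (# 0 ∷ # 1 ∷ # 0 ∷ # 7 ∷ # 4 ∷ # 8 ∷ []) ∷
  (# 0 ∷ # 1 ∷ # 2 ∷ # 6 ∷ # 2 ∷ # 8 ∷ []) ∷
  (# 0 ∷ # 1 ∷ # 8 ∷ # 1 ∷ # 3 ∷ # 8 ∷ []) ∷
  (# 0 ∷ # 1 ∷ # 8 ∷ # 5 ∷ # 4 ∷ # 8 ∷ []) ∷
  (# 0 ∷ # 2 ∷ # 3 ∷ # 5 ∷ # 7 ∷ # 8 ∷ []) ∷
  (# 0 ∷ # 2 ∷ # 8 ∷ # 7 ∷ # 2 ∷ # 8 ∷ []) ∷
  (# 0 ∷ # 3 ∷ # 0 ∷ # 6 ∷ # 3 ∷ # 8 ∷ []) ∷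
  (# 0 ∷ # 6 ∷ # 7 ∷ # 6 ∷ # 3 ∷ # 8 ∷ []) ∷ []

image : Letter → Fin 6 → Letter
image a = Vec.lookup (Vec.lookup imageTable a)

σ : Letter → List Letter
σ a = tabulate (image a)

-- 288 times the inverse of the incidence matrix of σ.
dualTable : Vec (Vec ℤ 9) 9
dualTable =
  (+ 77 ∷ - + 7 ∷ - + 43 ∷ - + 85 ∷ - + 145 ∷ + 53 ∷ + 5 ∷ - + 13 ∷ + 11 ∷ []) ∷
  (+ 37 ∷ + 49 ∷ + 13 ∷ + 19 ∷ + 151 ∷ - + 83 ∷ - + 35 ∷ + 91 ∷ - + 77 ∷ []) ∷
  (- + 5 ∷ + 79 ∷ + 115 ∷ + 13 ∷ + 73 ∷ + 19 ∷ + 67 ∷ - + 59 ∷ - + 83 ∷ []) ∷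
  (- + 36 ∷ + 108 ∷ - + 36 ∷ + 36 ∷ - + 108 ∷ - + 36 ∷ - + 36 ∷ + 36 ∷ + 36 ∷ []) ∷
  (- + 37 ∷ - + 49 ∷ - + 13 ∷ - + 19 ∷ + 137 ∷ + 83 ∷ + 35 ∷ - + 91 ∷ + 77 ∷ []) ∷
  (- + 40 ∷ + 56 ∷ + 56 ∷ + 104 ∷ + 8 ∷ + 152 ∷ - + 40 ∷ + 104 ∷ - + 88 ∷ []) ∷
  (+ 25 ∷ - + 107 ∷ + 1 ∷ - + 65 ∷ - + 77 ∷ - + 95 ∷ - + 47 ∷ + 7 ∷ + 127 ∷ []) ∷
  (+ 49 ∷ - + 83 ∷ + 25 ∷ + 103 ∷ + 91 ∷ - + 71 ∷ - + 23 ∷ - + 113 ∷ + 7 ∷ []) ∷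
  (- + 22 ∷ + 2 ∷ - + 70 ∷ - + 58 ∷ - + 82 ∷ + 26 ∷ + 122 ∷ + 86 ∷ + 38 ∷ []) ∷ []

dual : Letter → Letter → ℤ
dual t = Vec.lookup (Vec.lookup dualTable t)

wt : (Letter → ℤ) → List Letter → ℤ
wt w []       = 0ℤ
wt w (x ∷ xs) = w x ℤ.+ wt w xs

-- The Kronecker delta times `d`, in recursive form so that `sum-scaledδ` is a plain induction.
scaledδ : ℤ → ∀ {n} → Fin n → Fin n → ℤ
scaledδ d zero    zero    = d
scaledδ d zero    (suc _) = 0ℤ
scaledδ d (suc _) zero    = 0ℤ
scaledδ d (suc i) (suc j) = scaledδ d i j

dual-σ : ∀ t a → wt (dual t) (σ a) ≡ scaledδ (+ 288) t a
dual-σ = toWitness {a? = Fin.all? λ t → Fin.all? λ a → wt (dual t) (σ a) ℤ.≟ scaledδ (+ 288) t a} tt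

-- Every row of the dual table vanishes mod 288 on all images; this row also keeps the cut points free of
-- arithmetic progressions.
residueWt : Letter → ℤ
residueWt = dual (# 2)

-- A cut point inside a block σ a is described by the part of the block before it (inj₁) or after it (inj₂),
-- chosen so that blocks with the same residue at the cut share the description.
Cut : Set
Cut = List Letter ⊎ List Letter

cuts : Vec Cut 18
cuts =
  inj₁ [] ∷
  inj₁ (# 0 ∷ []) ∷
  inj₁ (# 0 ∷ # 1 ∷ []) ∷
  inj₁ (# 0 ∷ # 2 ∷ []) ∷
  inj₁ (# 0 ∷ # 3 ∷ []) ∷
  inj₁ (# 0 ∷ # 6 ∷ []) ∷
  inj₁ (# 0 ∷ # 1 ∷ # 0 ∷ []) ∷
  inj₁ (# 0 ∷ # 1 ∷ # 2 ∷ []) ∷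
  inj₁ (# 0 ∷ # 1 ∷ # 8 ∷ []) ∷
  inj₁ (# 0 ∷ # 2 ∷ # 3 ∷ []) ∷
  inj₁ (# 0 ∷ # 2 ∷ # 8 ∷ []) ∷
  inj₂ (# 6 ∷ # 3 ∷ # 8 ∷ []) ∷
  inj₁ (# 0 ∷ # 1 ∷ # 0 ∷ # 5 ∷ []) ∷
  inj₂ (# 4 ∷ # 8 ∷ []) ∷
  inj₂ (# 2 ∷ # 8 ∷ []) ∷
  inj₂ (# 3 ∷ # 8 ∷ []) ∷
  inj₁ (# 0 ∷ # 2 ∷ # 3 ∷ # 5 ∷ []) ∷
  inj₂ (# 8 ∷ []) ∷ []

cutTable : Vec (Vec (Fin 18) 6) 9
cutTable =
  (# 0 ∷ # 1 ∷ # 2 ∷ # 6 ∷ # 12 ∷ # 17 ∷ []) ∷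
  (# 0 ∷ # 1 ∷ # 2 ∷ # 6 ∷ # 13 ∷ # 17 ∷ []) ∷
  (# 0 ∷ # 1 ∷ # 2 ∷ # 7 ∷ # 14 ∷ # 17 ∷ []) ∷
  (# 0 ∷ # 1 ∷ # 2 ∷ # 8 ∷ # 15 ∷ # 17 ∷ []) ∷
  (# 0 ∷ # 1 ∷ # 2 ∷ # 8 ∷ # 13 ∷ # 17 ∷ []) ∷
  (# 0 ∷ # 1 ∷ # 3 ∷ # 9 ∷ # 16 ∷ # 17 ∷ []) ∷
  (# 0 ∷ # 1 ∷ # 3 ∷ # 10 ∷ # 14 ∷ # 17 ∷ []) ∷
  (# 0 ∷ # 1 ∷ # 4 ∷ # 11 ∷ # 15 ∷ # 17 ∷ []) ∷
  (# 0 ∷ # 1 ∷ # 5 ∷ # 11 ∷ # 15 ∷ # 17 ∷ []) ∷ []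

cut : Fin 18 → Cut
cut = Vec.lookup cuts

cutAt : Letter → Fin 6 → Fin 18
cutAt a = Vec.lookup (Vec.lookup cutTable a)

Describes : Cut → Letter → Fin 6 → Set
Describes (inj₁ p) a r = take (toℕ r) (σ a) ≡ p
Describes (inj₂ s) a r = drop (toℕ r) (σ a) ≡ s

describes? : ∀ c a r → Dec (Describes c a r)
describes? (inj₁ p) a r = ≡-dec Fin._≟_ _ _
describes? (inj₂ s) a r = ≡-dec Fin._≟_ _ _

cutAt-describes : ∀ a r → Describes (cut (cutAt a r)) a r
cutAt-describes = toWitness {a? = Fin.all? λ a → Fin.all? λ r → describes? (cut (cutAt a r)) a r} tt

-- A suffix is measured backwards from the end of its block: its weight enters negatively, and
-- `shift` moves the reference boundary one block on.
cutWt : (Letter → ℤ) → Cut → ℤ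
cutWt w (inj₁ p) = wt w p
cutWt w (inj₂ s) = - wt w s

shift : Cut → ℕ
shift (inj₁ _) = 0
shift (inj₂ _) = 1

-- The second difference; it vanishes exactly when `x`, `y`, `z` is an arithmetic progression.
defect : ℤ → ℤ → ℤ → ℤ
defect x y z = x ℤ.+ z ℤ.- (y ℤ.+ y)

residue : Fin 18 → ℤ
residue c = cutWt residueWt (cut c)

-- A finite check of all triples of cuts. Taking `% 288` of the absolute value expresses
-- divisibility of a signed integer.
residues-AP-free : ∀ x y z → ∣ defect (residue x) (residue y) (residue z) ∣ % 288 ≡ 0 → x ≡ y × y ≡ z
residues-AP-free = toWitness {a? = Fin.all? λ x → Fin.all? λ y → Fin.all? λ z →
  (∣ defect (residue x) (residue y) (residue z) ∣ % 288 ℕ.≟ 0) →-dec (x Fin.≟ y ×-dec y Fin.≟ z)} tt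

-- The fixed point of the morphism and its prefix weights

approximant : ℕ → ℕ → Letter
approximant zero    n = # 0
approximant (suc k) n = image (approximant k (n / 6)) (n ℕ.mod 6)

-- Each step divides the position by 6, so fuel `n` reaches the seed; by `approximant-stable` more
-- fuel changes nothing.
word : ℕ → Letter
word n = approximant n n

/6-≤ : ∀ n k → n ℕ.≤ suc k → n / 6 ℕ.≤ k
/6-≤ zero    k _   = z≤n
/6-≤ (suc n) k n≤k = ℕ.≤-pred (ℕ.≤-trans (ℕ.m/n<m (suc n) 6 (s≤s (s≤s z≤n))) n≤k)

approximant-stable : ∀ k l n → n ℕ.≤ k → n ℕ.≤ l → approximant k n ≡ approximant l n
approximant-stable zero    zero    n    _   _   = refl
-- At position 0 extra fuel only replaces 0 by the first letter of its image, which is 0 again.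
approximant-stable zero    (suc l) zero _   _   = cong (λ a → image a zero) (approximant-stable zero l zero z≤n z≤n)
approximant-stable (suc k) zero    zero _   _   = cong (λ a → image a zero) (approximant-stable k zero zero z≤n z≤n)
approximant-stable (suc k) (suc l) n    n≤k n≤l = cong (λ a → image a (n ℕ.mod 6)) (approximant-stable k l (n / 6) (/6-≤ n k n≤k) (/6-≤ n l n≤l))

word-fixed : ∀ n → word n ≡ image (word (n / 6)) (n ℕ.mod 6)
word-fixed zero    = refl
word-fixed (suc n) = cong (λ a → image a (suc n ℕ.mod 6)) (approximant-stable n (suc n / 6) (suc n / 6) (/6-≤ (suc n) n ℕ.≤-refl) ℕ.≤-refl)

word-image : ∀ q r → word (toℕ r ℕ.+ q ℕ.* 6) ≡ image (word q) r
word-image q r = trans (word-fixed i) (cong₂ (λ m → image (word m)) quot rem)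
  where
  i = toℕ r ℕ.+ q ℕ.* 6
  quot : i / 6 ≡ q
  quot = trans (ℕ.+-distrib-/-∣ʳ (toℕ r) (n∣m*n q)) (cong₂ ℕ._+_ (ℕ.m<n⇒m/n≡0 (toℕ<n r)) (ℕ.m*n/n≡m q 6))
  rem : i ℕ.mod 6 ≡ r
  rem = toℕ-injective (trans (toℕ-fromℕ< _) (trans (ℕ.[m+kn]%n≡m%n (toℕ r) q 6) (ℕ.m<n⇒m%n≡m (toℕ<n r))))

prefixWt : (Letter → ℤ) → ℕ → ℤ
prefixWt w zero    = 0ℤ
prefixWt w (suc n) = prefixWt w n ℤ.+ w (word n)

wt-++ : ∀ w xs ys → wt w (xs ++ ys) ≡ wt w xs ℤ.+ wt w ys
wt-++ w []       ys = sym (ℤ.+-identityˡ _)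
wt-++ w (x ∷ xs) ys = trans (cong (ℤ._+_ (w x)) (wt-++ w xs ys)) (sym (ℤ.+-assoc (w x) (wt w xs) (wt w ys)))

_∘σ : (Letter → ℤ) → Letter → ℤ
(w ∘σ) a = wt w (σ a)

prefixWt-take : ∀ w q k → k ℕ.≤ 6 → prefixWt w (k ℕ.+ q ℕ.* 6) ≡ prefixWt w (q ℕ.* 6) ℤ.+ wt w (take k (σ (word q)))
prefixWt-take w q zero    _   = sym (ℤ.+-identityʳ _)
prefixWt-take w q (suc k) k<6 with fromℕ< k<6 | Fin.toℕ-fromℕ< k<6
... | r | refl = begin
  prefixWt w (k ℕ.+ q ℕ.* 6) ℤ.+ w (word (k ℕ.+ q ℕ.* 6))
    ≡⟨ cong₂ ℤ._+_ (prefixWt-take w q k (ℕ.<⇒≤ k<6)) (trans (cong w (word-image q r)) (sym (ℤ.+-identityʳ _))) ⟩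
  (prefixWt w (q ℕ.* 6) ℤ.+ wt w (take k (σ (word q)))) ℤ.+ wt w (image (word q) r ∷ [])
    ≡⟨ ℤ.+-assoc (prefixWt w (q ℕ.* 6)) _ _ ⟩
  prefixWt w (q ℕ.* 6) ℤ.+ (wt w (take k (σ (word q))) ℤ.+ wt w (image (word q) r ∷ []))
    ≡⟨ cong (ℤ._+_ (prefixWt w (q ℕ.* 6))) (trans (sym (wt-++ w (take k (σ (word q))) (image (word q) r ∷ []))) (cong (wt w) (sym (take-suc-tabulate (image (word q)) r)))) ⟩
  prefixWt w (q ℕ.* 6) ℤ.+ wt w (take (suc k) (σ (word q))) ∎
  where open ≡-Reasoning

prefixWt-∘σ : ∀ w q → prefixWt w (q ℕ.* 6) ≡ prefixWt (w ∘σ) q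
prefixWt-∘σ w zero    = refl
prefixWt-∘σ w (suc q) = trans (prefixWt-take w q 6 ℕ.≤-refl) (cong (ℤ._+ wt w (σ (word q))) (prefixWt-∘σ w q))

-- Whole blocks contribute through `w ∘σ`. For a suffix description the current block is completed,
-- and what lies beyond the cut is subtracted again.
prefixWt-cut : ∀ w q r → let c = cut (cutAt (word q) r) in
  prefixWt w (toℕ r ℕ.+ q ℕ.* 6) ≡ prefixWt (w ∘σ) (shift c ℕ.+ q) ℤ.+ cutWt w c
prefixWt-cut w q r with cut (cutAt (word q) r) | cutAt-describes (word q) r
... | inj₁ p | refl = trans (prefixWt-take w q (toℕ r) (ℕ.<⇒≤ (toℕ<n r))) (cong (ℤ._+ wt w p) (prefixWt-∘σ w q))
... | inj₂ s | refl = begin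
  prefixWt w (toℕ r ℕ.+ q ℕ.* 6)
    ≡⟨ prefixWt-take w q (toℕ r) (ℕ.<⇒≤ (toℕ<n r)) ⟩
  prefixWt w (q ℕ.* 6) ℤ.+ wt w p
    ≡⟨ cong (ℤ._+ wt w p) (prefixWt-∘σ w q) ⟩
  prefixWt (w ∘σ) q ℤ.+ wt w p
    ≡⟨ lemma (prefixWt (w ∘σ) q) (wt w p) (wt w s) ⟩
  (prefixWt (w ∘σ) q ℤ.+ (wt w p ℤ.+ wt w s)) ℤ.- wt w s
    ≡⟨ cong (λ x → (prefixWt (w ∘σ) q ℤ.+ x) ℤ.- wt w s) (trans (sym (wt-++ w p s)) (cong (wt w) (take++drop≡id (toℕ r) (σ (word q))))) ⟩
  prefixWt (w ∘σ) (suc q) ℤ.- wt w s ∎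
  where
  open ≡-Reasoning
  p = take (toℕ r) (σ (word q))
  lemma : ∀ x y z → x ℤ.+ y ≡ (x ℤ.+ (y ℤ.+ z)) ℤ.- z
  lemma = ℤ-solve-∀

prefixWt-cong : ∀ {w v} → (∀ a → w a ≡ v a) → ∀ n → prefixWt w n ≡ prefixWt v n
prefixWt-cong eq zero    = refl
prefixWt-cong eq (suc n) = cong₂ ℤ._+_ (prefixWt-cong eq n) (eq (word n))

prefixWt-scale : ∀ d w n → prefixWt (λ a → d ℤ.* w a) n ≡ d ℤ.* prefixWt w n
prefixWt-scale d w zero    = sym (ℤ.*-zeroʳ d)
prefixWt-scale d w (suc n) = trans (cong (ℤ._+ d ℤ.* w (word n)) (prefixWt-scale d w n)) (sym (ℤ.*-distribˡ-+ d (prefixWt w n) (w (word n))))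

-- Inverting the incidence matrix

wt-sum : ∀ {n} (c : Fin n → ℤ) (b : Fin n → Letter → ℤ) xs →
  wt (λ a → sum (λ t → c t ℤ.* b t a)) xs ≡ sum (λ t → c t ℤ.* wt (b t) xs)
wt-sum {n} c b [] = sym (trans (sum-cong-≗ (λ t → ℤ.*-zeroʳ (c t))) (sum-replicate-zero n))
wt-sum c b (x ∷ xs) = begin
  sum (λ t → c t ℤ.* b t x) ℤ.+ wt (λ a → sum (λ t → c t ℤ.* b t a)) xs
    ≡⟨ cong (ℤ._+_ (sum (λ t → c t ℤ.* b t x))) (wt-sum c b xs) ⟩
  sum (λ t → c t ℤ.* b t x) ℤ.+ sum (λ t → c t ℤ.* wt (b t) xs)
    ≡⟨ ∑-distrib-+ (λ t → c t ℤ.* b t x) (λ t → c t ℤ.* wt (b t) xs) ⟨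
  sum (λ t → c t ℤ.* b t x ℤ.+ c t ℤ.* wt (b t) xs)
    ≡⟨ sum-cong-≗ (λ t → ℤ.*-distribˡ-+ (c t) (b t x) (wt (b t) xs)) ⟨
  sum (λ t → c t ℤ.* (b t x ℤ.+ wt (b t) xs)) ∎
  where open ≡-Reasoning

sum-scaledδ : ∀ d {n} (c : Fin n → ℤ) i → sum (λ t → c t ℤ.* scaledδ d t i) ≡ d ℤ.* c i
sum-scaledδ d {suc n} c zero = begin
  c zero ℤ.* d ℤ.+ sum (λ t → c (suc t) ℤ.* 0ℤ)
    ≡⟨ cong₂ ℤ._+_ (ℤ.*-comm (c zero) d) (trans (sum-cong-≗ (λ t → ℤ.*-zeroʳ (c (suc t)))) (sum-replicate-zero n)) ⟩
  d ℤ.* c zero ℤ.+ 0ℤ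
    ≡⟨ ℤ.+-identityʳ _ ⟩
  d ℤ.* c zero ∎
  where open ≡-Reasoning
sum-scaledδ d c (suc i) = trans (cong₂ ℤ._+_ (ℤ.*-zeroʳ (c zero)) (sum-scaledδ d (c ∘ suc) i)) (ℤ.+-identityˡ _)

-- Solves `v ∘σ` = 288 · `w` for `v`, with the rows of the scaled inverse matrix as a dual basis.
dualCombination : (Letter → ℤ) → Letter → ℤ
dualCombination w a = sum (λ t → w t ℤ.* dual t a)

dualCombination-∘σ : ∀ w a → (dualCombination w ∘σ) a ≡ + 288 ℤ.* w a
dualCombination-∘σ w a = begin
  wt (dualCombination w) (σ a)
    ≡⟨ wt-sum w dual (σ a) ⟩
  sum (λ t → w t ℤ.* wt (dual t) (σ a))
    ≡⟨ sum-cong-≗ (λ t → cong (w t ℤ.*_) (dual-σ t a)) ⟩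
  sum (λ t → w t ℤ.* scaledδ (+ 288) t a)
    ≡⟨ sum-scaledδ (+ 288) w a ⟩
  + 288 ℤ.* w a ∎
  where open ≡-Reasoning

squareDefect : (Letter → ℤ) → ℕ → ℕ → ℕ → ℤ
squareDefect w l m n = defect (prefixWt w l) (prefixWt w m) (prefixWt w n)

squareDefect-scale : ∀ d {w v} → (∀ a → v a ≡ d ℤ.* w a) → ∀ l m n → squareDefect v l m n ≡ d ℤ.* squareDefect w l m n
squareDefect-scale d {w} {v} eq l m n = trans
  (cong₂ ℤ._-_ (cong₂ ℤ._+_ (scale l) (scale n)) (cong₂ ℤ._+_ (scale m) (scale m)))
  (ring d (prefixWt w l) (prefixWt w m) (prefixWt w n))
  where
  scale : ∀ k → prefixWt v k ≡ d ℤ.* prefixWt w k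
  scale k = trans (prefixWt-cong eq k) (prefixWt-scale d w k)
  ring : ∀ d x y z → d ℤ.* x ℤ.+ d ℤ.* z ℤ.- (d ℤ.* y ℤ.+ d ℤ.* y) ≡ d ℤ.* (x ℤ.+ z ℤ.- (y ℤ.+ y))
  ring = ℤ-solve-∀

-- The positions l, m, n bound two consecutive factors; equality of all their weights says that they are
-- permutations of each other.
AbelianSquare : ℕ → ℕ → ℕ → Set
AbelianSquare l m n = ∀ w → squareDefect w l m n ≡ 0ℤ

-- The pullbacks along `σ` include 288 times every functional, so testing on pullbacks tests
-- everything.
desubstitute : ∀ l m n → (∀ w → squareDefect (w ∘σ) l m n ≡ 0ℤ) → AbelianSquare l m n
desubstitute l m n sq w = ℤ.*-cancelˡ-≡ (+ 288) _ _ (trans (sym (squareDefect-scale (+ 288) (dualCombination-∘σ w) l m n)) (sq (dualCombination w)))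

-- Descent on abelian squares

record Decomposition (n : ℕ) : Set where
  field
    q  : ℕ
    r  : Fin 6
    eq : n ≡ toℕ r ℕ.+ q ℕ.* 6
  index = cutAt (word q) r
  -- The block boundary to which the cut is moved: the start of the block for a prefix description,
  -- its end for a suffix description.
  q′ = shift (cut index) ℕ.+ q

decompose : ∀ n → Decomposition n
decompose n with n ℕ.divMod 6
... | ℕ.result q r eq = record { q = q ; r = r ; eq = eq }

prefixWt-decompose : ∀ w {n} (d : Decomposition n) → let open Decomposition d in
  prefixWt w n ≡ prefixWt (w ∘σ) q′ ℤ.+ cutWt w (cut index)
prefixWt-decompose w d = trans (cong (prefixWt w) eq) (prefixWt-cut w q r)
  where open Decomposition d

defect-+ : ∀ x y z a b c → defect (x ℤ.+ a) (y ℤ.+ b) (z ℤ.+ c) ≡ defect x y z ℤ.+ defect a b c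
defect-+ = ring
  where
  ring : ∀ x y z a b c → (x ℤ.+ a) ℤ.+ (z ℤ.+ c) ℤ.- ((y ℤ.+ b) ℤ.+ (y ℤ.+ b)) ≡ (x ℤ.+ z ℤ.- (y ℤ.+ y)) ℤ.+ (a ℤ.+ c ℤ.- (b ℤ.+ b))
  ring = ℤ-solve-∀

residueWt-∘σ : ∀ a → (residueWt ∘σ) a ≡ + 288 ℤ.* scaledδ 1ℤ (# 2) a
residueWt-∘σ = toWitness {a? = Fin.all? λ a → (residueWt ∘σ) a ℤ.≟ + 288 ℤ.* scaledδ 1ℤ (# 2) a} tt

-- Different letters may share a cut, but never at different offsets; hence equal cuts let the order
-- of positions pass to block numbers.
cutAt-offset : ∀ a r b s → cutAt a r ≡ cutAt b s → r ≡ s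
cutAt-offset = toWitness {a? = Fin.all? λ a → Fin.all? λ r → Fin.all? λ b → Fin.all? λ s → (cutAt a r Fin.≟ cutAt b s) →-dec (r Fin.≟ s)} tt

∣-from-sum : ∀ d .{{_ : ℕ.NonZero d}} y z → + d ℤ.* y ℤ.+ z ≡ 0ℤ → ∣ z ∣ % d ≡ 0
∣-from-sum d y z eq = begin
  ∣ z ∣ % d
    ≡⟨ cong (λ x → ∣ x ∣ % d) z≡ ⟩
  ∣ + d ℤ.* (- y) ∣ % d
    ≡⟨ cong (_% d) (trans (ℤ.abs-* (+ d) (- y)) (ℕ.*-comm d ∣ - y ∣)) ⟩
  ∣ - y ∣ ℕ.* d % d
    ≡⟨ ℕ.m*n%n≡0 ∣ - y ∣ d ⟩
  0 ∎
  where
  open ≡-Reasoning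
  ring : ∀ d y z → z ≡ (d ℤ.* y ℤ.+ z) ℤ.+ d ℤ.* (- y)
  ring = ℤ-solve-∀
  z≡ : z ≡ + d ℤ.* (- y)
  z≡ = trans (ring (+ d) y z) (trans (cong (ℤ._+ + d ℤ.* (- y)) eq) (ℤ.+-identityˡ _))

module _ {l m n} (dl : Decomposition l) (dm : Decomposition m) (dn : Decomposition n) (sq : AbelianSquare l m n) where
  private
    module L = Decomposition dl
    module M = Decomposition dm
    module N = Decomposition dn

  defect-cuts : ∀ w → squareDefect (w ∘σ) L.q′ M.q′ N.q′ ℤ.+
    defect (cutWt w (cut L.index)) (cutWt w (cut M.index)) (cutWt w (cut N.index)) ≡ 0ℤ
  defect-cuts w = begin
    defect (prefixWt (w ∘σ) L.q′) (prefixWt (w ∘σ) M.q′) (prefixWt (w ∘σ) N.q′) ℤ.+ defect (cutWt w (cut L.index)) (cutWt w (cut M.index)) (cutWt w (cut N.index))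
      ≡⟨ defect-+ (prefixWt (w ∘σ) L.q′) (prefixWt (w ∘σ) M.q′) (prefixWt (w ∘σ) N.q′) _ _ _ ⟨
    defect (prefixWt (w ∘σ) L.q′ ℤ.+ cutWt w (cut L.index)) (prefixWt (w ∘σ) M.q′ ℤ.+ cutWt w (cut M.index)) (prefixWt (w ∘σ) N.q′ ℤ.+ cutWt w (cut N.index))
      ≡⟨ cong₂ ℤ._-_ (cong₂ ℤ._+_ (prefixWt-decompose w dl) (prefixWt-decompose w dn)) (cong₂ ℤ._+_ (prefixWt-decompose w dm) (prefixWt-decompose w dm)) ⟨
    squareDefect w l m n
      ≡⟨ sq w ⟩
    0ℤ ∎
    where open ≡-Reasoning

  -- Under `residueWt` the block parts contribute a multiple of 288, so the three cut residues form
  -- an arithmetic progression mod 288, which must be trivial.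
  same-cut : L.index ≡ M.index × M.index ≡ N.index
  same-cut = residues-AP-free L.index M.index N.index (∣-from-sum 288 y z
    (trans (cong (ℤ._+ z) (sym (squareDefect-scale (+ 288) residueWt-∘σ L.q′ M.q′ N.q′))) (defect-cuts residueWt)))
    where
    y = squareDefect (scaledδ 1ℤ (# 2)) L.q′ M.q′ N.q′
    z = defect (residue L.index) (residue M.index) (residue N.index)

  -- Equal cuts have defect zero under every weight, so the block boundaries alone balance all
  -- pullbacks.
  smaller-square : AbelianSquare L.q′ M.q′ N.q′
  smaller-square = desubstitute L.q′ M.q′ N.q′ λ w → trans (sym (trans
    (cong (λ x → squareDefect (w ∘σ) L.q′ M.q′ N.q′ ℤ.+ x) (defect-const (cong (cutWt w ∘ cut) (proj₁ same-cut)) (cong (cutWt w ∘ cut) (proj₂ same-cut))))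
    (ℤ.+-identityʳ _))) (defect-cuts w)
    where
    defect-const : ∀ {x y z} → x ≡ y → y ≡ z → defect x y z ≡ 0ℤ
    defect-const {x} refl refl = ℤ.+-inverseʳ (x ℤ.+ x)

  -- Equal cuts have equal offset and shift, so `l < n` gives `L.q < N.q`. In particular `N.q` is
  -- positive, whence `N.q′` ≤ `N.q` + 1 < 6 · `N.q` ≤ `n`.
  smaller-ordered : l ℕ.< n → L.q′ ℕ.< N.q′ × N.q′ ℕ.< n
  smaller-ordered l<n =
    subst (λ k → k ℕ.+ L.q ℕ.< N.q′) (sym same-shift) (ℕ.+-monoʳ-< (shift (cut N.index)) q<q) , bound
    where
    same-shift : shift (cut L.index) ≡ shift (cut N.index)
    same-shift = cong (shift ∘ cut) (trans (proj₁ same-cut) (proj₂ same-cut))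
    offset : L.r ≡ N.r
    offset = cutAt-offset (word L.q) L.r (word N.q) N.r (trans (proj₁ same-cut) (proj₂ same-cut))
    q<q : L.q ℕ.< N.q
    q<q = ℕ.*-cancelʳ-< 6 L.q N.q (ℕ.+-cancelˡ-< (toℕ L.r) _ _ (subst₂ ℕ._<_ L.eq (trans N.eq (cong (λ r → toℕ r ℕ.+ N.q ℕ.* 6) (sym offset))) l<n))
    shift≤1 : ∀ c → shift c ℕ.≤ 1
    shift≤1 (inj₁ _) = z≤n
    shift≤1 (inj₂ _) = s≤s z≤n
    bound : N.q′ ℕ.< n
    bound = begin-strict
      shift (cut N.index) ℕ.+ N.q ≤⟨ ℕ.+-monoˡ-≤ N.q (shift≤1 (cut N.index)) ⟩
      suc N.q                      <⟨ lemma N.q (ℕ.m<n⇒0<n q<q) ⟩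
      N.q ℕ.* 6                    ≤⟨ ℕ.m≤n+m (N.q ℕ.* 6) (toℕ N.r) ⟩
      toℕ N.r ℕ.+ N.q ℕ.* 6        ≡⟨ N.eq ⟨
      n ∎
      where
      open ℕ.≤-Reasoning
      lemma : ∀ q → 0 ℕ.< q → suc q ℕ.< q ℕ.* 6
      lemma (suc q) _ = s≤s (s≤s (s≤s (ℕ.≤-trans (ℕ.m≤m*n q 6) (ℕ.m≤n+m (q ℕ.* 6) 3))))

-- Infinite descent on the right end `n`.
word-abelian-square-free : ∀ l m n → l ℕ.< n → ¬ AbelianSquare l m n
word-abelian-square-free l m n = go l m (<-wellFounded n)
  where
  go : ∀ l m {n} → Acc ℕ._<_ n → l ℕ.< n → ¬ AbelianSquare l m n
  go l m {n} (acc rec) l<n sq =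
    go L.q′ M.q′ (rec (proj₂ ord)) (proj₁ ord) (smaller-square dl dm dn sq)
    where
    dl = decompose l
    dm = decompose m
    dn = decompose n
    module L = Decomposition dl
    module M = Decomposition dm
    ord = smaller-ordered dl dm dn sq l<n

-- Walks inside one edge

data Colour : Set where
  original : Colour
  mark     : ℕ → Colour
  letter   : Letter → Colour

odd : ℕ → Bool
odd 0             = false
odd 1             = true
odd (suc (suc n)) = odd n

pick : Bool → ℕ → ℕ → Colour
pick false s k = mark s
pick true  s k = letter (word k)

-- Positions 2k and 2k + 1 form slot k: the first carries a marker, the second the k-th letter of
-- `word`. A segment consists of `t` slots.
colourAt : (t : ℕ) .{{_ : NonZero t}} → ℕ → Colour
colourAt t j = pick (odd j) (⌊ j /2⌋ / t) ⌊ j /2⌋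

letterWt : (Letter → ℤ) → Colour → ℤ
letterWt w (letter a) = w a
letterWt w _          = 0ℤ

letterSum : (Letter → ℤ) → List Colour → ℤ
letterSum w []       = 0ℤ
letterSum w (c ∷ cs) = letterWt w c ℤ.+ letterSum w cs

letterSum-↭ : ∀ w {cs ds} → cs ↭ ds → letterSum w cs ≡ letterSum w ds
letterSum-↭ w ↭.refl = refl
letterSum-↭ w (↭.prep c p) = cong (ℤ._+_ (letterWt w c)) (letterSum-↭ w p)
letterSum-↭ w (↭.swap {xs = xs} {ys = ys} c d p) = trans
  (cong (λ z → letterWt w c ℤ.+ (letterWt w d ℤ.+ z)) (letterSum-↭ w p))
  (ring (letterWt w c) (letterWt w d) (letterSum w ys))
  where
  ring : ∀ x y z → x ℤ.+ (y ℤ.+ z) ≡ y ℤ.+ (x ℤ.+ z)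
  ring = ℤ-solve-∀
letterSum-↭ w (↭.trans p q) = trans (letterSum-↭ w p) (letterSum-↭ w q)

⌊1+n/2⌋ : ∀ n → ⌊ suc n /2⌋ ≡ (if odd n then suc ⌊ n /2⌋ else ⌊ n /2⌋)
⌊1+n/2⌋ 0 = refl
⌊1+n/2⌋ 1 = refl
⌊1+n/2⌋ (suc (suc n)) with odd n | ⌊1+n/2⌋ n
... | true  | eq = cong suc eq
... | false | eq = cong suc eq

-- The letters at positions below `n` are the first `⌊ n /2⌋` letters of `word`, so this is their
-- total weight.
halfWt : (Letter → ℤ) → ℕ → ℤ
halfWt w n = prefixWt w ⌊ n /2⌋

-- Half-open runs, so that concatenation shares one endpoint: `Ascent a xs b` lists a, ..., b - 1,
-- while `Descent a xs b` lists a - 1, ..., b.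
data Ascent : ℕ → List ℕ → ℕ → Set where
  done : ∀ {a} → Ascent a [] a
  step : ∀ {a b xs} → Ascent (suc a) xs b → Ascent a (a ∷ xs) b

data Descent : ℕ → List ℕ → ℕ → Set where
  done : ∀ {a} → Descent a [] a
  step : ∀ {a b xs} → Descent a xs b → Descent (suc a) (a ∷ xs) b

ascent-++ : ∀ {a b} xs {ys} → Ascent a (xs ++ ys) b → ∃[ m ] Ascent a xs m × Ascent m ys b
ascent-++ []       r        = _ , done , r
ascent-++ (x ∷ xs) (step r) = let m , p , q = ascent-++ xs r in m , step p , q

descent-++ : ∀ {a b} xs {ys} → Descent a (xs ++ ys) b → ∃[ m ] Descent a xs m × Descent m ys b
descent-++ []       r        = _ , done , r
descent-++ (x ∷ xs) (step r) = let m , p , q = descent-++ xs r in m , step p , q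

ascent-length : ∀ {a b xs} → Ascent a xs b → length xs ℕ.+ a ≡ b
ascent-length done     = refl
ascent-length (step r) = trans (sym (ℕ.+-suc _ _)) (ascent-length r)

descent-length : ∀ {a b xs} → Descent a xs b → length xs ℕ.+ b ≡ a
descent-length done     = refl
descent-length (step r) = cong suc (descent-length r)

module _ (t : ℕ) .{{_ : NonZero t}} where

  halfWt-suc : ∀ w n → halfWt w (suc n) ≡ halfWt w n ℤ.+ letterWt w (colourAt t n)
  halfWt-suc w n rewrite ⌊1+n/2⌋ n with odd n
  ... | true  = refl
  ... | false = sym (ℤ.+-identityʳ _)

  colourSum : (Letter → ℤ) → List ℕ → ℤ
  colourSum w xs = letterSum w (map (colourAt t) xs)

  ascent-sum : ∀ w {a b xs} → Ascent a xs b → halfWt w a ℤ.+ colourSum w xs ≡ halfWt w b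
  ascent-sum w done = ℤ.+-identityʳ _
  ascent-sum w (step {a} {b} {xs} r) = begin
    halfWt w a ℤ.+ (c ℤ.+ colourSum w xs) ≡⟨ ℤ.+-assoc (halfWt w a) c _ ⟨
    halfWt w a ℤ.+ c ℤ.+ colourSum w xs   ≡⟨ cong (ℤ._+ colourSum w xs) (halfWt-suc w a) ⟨
    halfWt w (suc a) ℤ.+ colourSum w xs   ≡⟨ ascent-sum w r ⟩
    halfWt w b ∎
    where
    open ≡-Reasoning
    c = letterWt w (colourAt t a)

  descent-sum : ∀ w {a b xs} → Descent a xs b → halfWt w b ℤ.+ colourSum w xs ≡ halfWt w a
  descent-sum w done = ℤ.+-identityʳ _
  descent-sum w (step {a} {b} {xs} r) = begin
    halfWt w b ℤ.+ (c ℤ.+ colourSum w xs) ≡⟨ ring (halfWt w b) c (colourSum w xs) ⟩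
    halfWt w b ℤ.+ colourSum w xs ℤ.+ c   ≡⟨ cong (ℤ._+ c) (descent-sum w r) ⟩
    halfWt w a ℤ.+ c                      ≡⟨ halfWt-suc w a ⟨
    halfWt w (suc a) ∎
    where
    open ≡-Reasoning
    c = letterWt w (colourAt t a)
    ring : ∀ x y z → x ℤ.+ (y ℤ.+ z) ≡ x ℤ.+ z ℤ.+ y
    ring = ℤ-solve-∀

  -- Equal letter sums from `l` to `m` and from `m` to `n` would be an abelian square of `word`. The
  -- gap of two keeps the halved endpoints distinct. For a descent the two halves are passed in
  -- reverse order.
  halfWt-not-balanced : ∀ {l m n} → suc (suc l) ℕ.≤ n → (s s′ : (Letter → ℤ) → ℤ) → (∀ w → s w ≡ s′ w) →
    (∀ w → halfWt w l ℤ.+ s w ≡ halfWt w m) → ¬ (∀ w → halfWt w m ℤ.+ s′ w ≡ halfWt w n)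
  halfWt-not-balanced {l} {m} {n} l<n s s′ same lm mn = word-abelian-square-free ⌊ l /2⌋ ⌊ m /2⌋ ⌊ n /2⌋ (ℕ.⌊n/2⌋-mono l<n) balanced
    where
    balanced : ∀ w → squareDefect w ⌊ l /2⌋ ⌊ m /2⌋ ⌊ n /2⌋ ≡ 0ℤ
    balanced w = begin
      halfWt w l ℤ.+ halfWt w n ℤ.- (halfWt w m ℤ.+ halfWt w m)
        ≡⟨ cong₂ (λ x y → halfWt w l ℤ.+ x ℤ.- (halfWt w m ℤ.+ y)) (mn w) (trans (cong (ℤ._+_ (halfWt w l)) (sym (same w))) (lm w)) ⟨
      halfWt w l ℤ.+ (halfWt w m ℤ.+ s′ w) ℤ.- (halfWt w m ℤ.+ (halfWt w l ℤ.+ s′ w))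
        ≡⟨ ring (halfWt w l) (halfWt w m) (s′ w) ⟩
      0ℤ ∎
      where
      open ≡-Reasoning
      ring : ∀ x y z → x ℤ.+ (y ℤ.+ z) ℤ.- (y ℤ.+ (x ℤ.+ z)) ≡ 0ℤ
      ring = ℤ-solve-∀

  2≤length : ∀ {xs ys : List ℕ} → xs ≢ [] → length xs ≡ length ys → 2 ℕ.≤ length (xs ++ ys)
  2≤length {[]}             nonempty _  = ⊥-elim (nonempty refl)
  2≤length {x ∷ xs} {y ∷ ys} _       eq = ℕ.s≤s (subst (1 ℕ.≤_) (sym (length-++ xs)) (ℕ.≤-trans (ℕ.s≤s ℕ.z≤n) (ℕ.m≤n+m _ (length xs))))

  module _ {xs ys : List ℕ} (nonempty : xs ≢ []) (perm : map (colourAt t) xs ↭ map (colourAt t) ys) where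

    private
      long : 2 ℕ.≤ length (xs ++ ys)
      long = 2≤length nonempty (trans (sym (length-map (colourAt t) xs)) (trans (↭-length perm) (length-map (colourAt t) ys)))

    ascent-not-anagram : ∀ {a b} → ¬ Ascent a (xs ++ ys) b
    ascent-not-anagram {a} r with ascent-++ xs r
    ... | m , p , q = halfWt-not-balanced {m = m}
      (subst (suc (suc a) ℕ.≤_) (ascent-length r) (ℕ.+-monoˡ-≤ a long))
      (λ w → colourSum w xs) (λ w → colourSum w ys) (λ w → letterSum-↭ w perm)
      (λ w → ascent-sum w p) (λ w → ascent-sum w q)

    descent-not-anagram : ∀ {a b} → ¬ Descent a (xs ++ ys) b
    descent-not-anagram {b = b} r with descent-++ xs r
    ... | m , p , q = halfWt-not-balanced {m = m}
      (subst (suc (suc b) ℕ.≤_) (descent-length r) (ℕ.+-monoˡ-≤ b long))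
      (λ w → colourSum w ys) (λ w → colourSum w xs) (λ w → sym (letterSum-↭ w perm))
      (λ w → descent-sum w q) (λ w → descent-sum w p)

Neighbours : ℕ → ℕ → Set
Neighbours x y = y ≡ suc x ⊎ x ≡ suc y

ascends : ∀ x xs → Linked Neighbours (x ∷ suc x ∷ xs) → Unique (x ∷ suc x ∷ xs) → ∃[ b ] Ascent x (x ∷ suc x ∷ xs) b
ascends x []       _                        _ = _ , step (step done)
ascends x (y ∷ ys) (_ ∷ inj₁ refl ∷ l)      (_ ∷ u) = let b , r = ascends (suc x) ys (inj₁ refl ∷ l) u in b , step r
ascends x (y ∷ ys) (_ ∷ inj₂ refl ∷ l)      ((_ ∷ x≢y ∷ _) ∷ _) = ⊥-elim (x≢y refl)

descends : ∀ x xs → Linked Neighbours (suc x ∷ x ∷ xs) → Unique (suc x ∷ x ∷ xs) → ∃[ b ] Descent (suc (suc x)) (suc x ∷ x ∷ xs) b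
descends x []       _                        _ = _ , step (step done)
descends x (y ∷ ys) (_ ∷ inj₂ refl ∷ l)      (_ ∷ u) = let b , r = descends y ys (inj₂ refl ∷ l) u in b , step r
descends x (y ∷ ys) (_ ∷ inj₁ refl ∷ l)      ((_ ∷ x≢y ∷ _) ∷ _) = ⊥-elim (x≢y refl)

-- Turning round would revisit the position before last, so the first step fixes the direction.
monotone : ∀ xs → Linked Neighbours xs → Unique xs → ∃[ a ] ∃[ b ] (Ascent a xs b ⊎ Descent a xs b)
monotone []           _               _ = 0 , 0 , inj₁ done
monotone (x ∷ [])     _               _ = x , suc x , inj₁ (step done)
monotone (x ∷ y ∷ xs) l@(inj₁ refl ∷ _) u = let b , r = ascends x xs l u in _ , b , inj₁ r
monotone (x ∷ y ∷ xs) l@(inj₂ refl ∷ _) u = let b , r = descends y xs l u in _ , b , inj₂ r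

walk-not-anagram : ∀ t .{{_ : NonZero t}} {xs ys} → xs ≢ [] → map (colourAt t) xs ↭ map (colourAt t) ys →
  Linked Neighbours (xs ++ ys) → ¬ Unique (xs ++ ys)
walk-not-anagram t nonempty perm l u with monotone _ l u
... | _ , _ , inj₁ r = ascent-not-anagram t nonempty perm r
... | _ , _ , inj₂ r = descent-not-anagram t nonempty perm r

-- Lists, paths and dyadic counting

module _ {A B : Set} where

  map-++⁻ : (f : A → B) → ∀ xs {ys zs} → map f xs ≡ ys ++ zs →
    ∃[ us ] ∃[ vs ] xs ≡ us ++ vs × map f us ≡ ys × map f vs ≡ zs
  map-++⁻ f xs       {[]}     eq   = [] , xs , refl , refl , eq
  map-++⁻ f (x ∷ xs) {_ ∷ ys} eq with map-++⁻ f xs {ys} (∷-injectiveʳ eq) | ∷-injectiveˡ eq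
  ... | us , vs , refl , refl , eq′ | refl = x ∷ us , vs , refl , refl , eq′

  length-filter-map : ∀ {P : B → Set} (P? : Decidable P) (f : A → B) xs →
    length (filter P? (map f xs)) ≡ length (filter (P? ∘ f) xs)
  length-filter-map P? f []       = refl
  length-filter-map P? f (x ∷ xs) with does (P? (f x))
  ... | true  = cong suc (length-filter-map P? f xs)
  ... | false = length-filter-map P? f xs

  -- The pigeonhole principle, by deleting from `ys` the image of the head of `xs`.
  length-≤ : (f : A → B) → ∀ {xs ys} → Unique xs → (∀ {x} → x ∈ xs → f x ∈ ys) →
    (∀ {x y} → x ∈ xs → y ∈ xs → f x ≡ f y → x ≡ y) → length xs ℕ.≤ length ys
  length-≤ f {[]}     _         _  _   = z≤n
  length-≤ f {x ∷ xs} (x∉ ∷ un) ⊆ys inj with ∈-∃++ (⊆ys (here refl))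
  ... | us , vs , refl = subst (suc (length xs) ℕ.≤_) eq (s≤s (length-≤ f un ⊆us++vs λ p q → inj (there p) (there q)))
    where
    eq : suc (length (us ++ vs)) ≡ length (us ++ f x ∷ vs)
    eq = trans (cong suc (length-++ us)) (trans (sym (ℕ.+-suc (length us) (length vs))) (sym (length-++ us)))
    ⊆us++vs : ∀ {y} → y ∈ xs → f y ∈ us ++ vs
    ⊆us++vs y∈ with ∈-++⁻ us (⊆ys (there y∈))
    ... | inj₁ p          = ∈-++⁺ˡ p
    ... | inj₂ (there p)  = ∈-++⁺ʳ us p
    ... | inj₂ (here fy≡) = ⊥-elim (All.lookup x∉ y∈ (inj (here refl) (there y∈) (sym fy≡)))

module _ {A : Set} where

  lastOf : A → List A → A
  lastOf x []       = x
  lastOf x (y ∷ ys) = lastOf y ys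

  lastOf-∈ : ∀ x xs → lastOf x xs ∈ x ∷ xs
  lastOf-∈ x []       = here refl
  lastOf-∈ x (y ∷ ys) = there (lastOf-∈ y ys)

  Unique-++ˡ : ∀ xs {ys : List A} → Unique (xs ++ ys) → Unique xs
  Unique-++ˡ []       _       = []
  Unique-++ˡ (x ∷ xs) (p ∷ u) = All.++⁻ˡ xs p ∷ Unique-++ˡ xs u

  Unique-++-disjoint : ∀ xs {ys : List A} → Unique (xs ++ ys) → ∀ {x} → x ∈ xs → ¬ x ∈ ys
  Unique-++-disjoint (x ∷ xs) (p ∷ u) (here refl) q = All.lookup p (∈-++⁺ʳ xs q) refl
  Unique-++-disjoint (x ∷ xs) (p ∷ u) (there r)   q = Unique-++-disjoint xs u r q

  Unique-lastOf : ∀ x xs {ys : List A} → Unique (x ∷ xs ++ ys) → Unique (lastOf x xs ∷ ys)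
  Unique-lastOf x []       u       = u
  Unique-lastOf x (y ∷ xs) (_ ∷ u) = Unique-lastOf y xs u

  module _ {R : A → A → Set} where

    Linked-++ˡ : ∀ xs {ys : List A} → Linked R (xs ++ ys) → Linked R xs
    Linked-++ˡ []           _       = []
    Linked-++ˡ (x ∷ [])     _       = [-]
    Linked-++ˡ (x ∷ y ∷ xs) (r ∷ l) = r ∷ Linked-++ˡ (y ∷ xs) l

    Linked-lastOf : ∀ x xs {ys : List A} → Linked R (x ∷ xs ++ ys) → Linked R (lastOf x xs ∷ ys)
    Linked-lastOf x []       l       = l
    Linked-lastOf x (y ∷ xs) (_ ∷ l) = Linked-lastOf y xs l

    -- Applied to division vertices, which have degree two: an interior one has both its graph
    -- neighbours on the path.
    interior-neighbours : ∀ {a} x xs → Linked R (x ∷ xs) → Unique (x ∷ xs) → a ∈ xs → a ≢ lastOf x xs →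
      ∃[ p ] ∃[ q ] p ∈ x ∷ xs × q ∈ x ∷ xs × p ≢ q × R p a × R a q
    interior-neighbours x (a ∷ [])     _ _ (here refl) a≢ = ⊥-elim (a≢ refl)
    interior-neighbours x (a ∷ q ∷ xs) (r ∷ s ∷ _) ((_ ∷ x≢q ∷ _) ∷ _) (here refl) _ =
      x , q , here refl , there (there (here refl)) , x≢q , r , s
    interior-neighbours x (y ∷ ys) (_ ∷ l) (_ ∷ u) (there a∈) a≢ =
      let p , q , p∈ , q∈ , rest = interior-neighbours y ys l u a∈ a≢ in p , q , there p∈ , there q∈ , rest

    constant-on-Linked : ∀ {B : Set} (f : A → B) x xs →
      (∀ {y z} → y ∈ x ∷ xs → z ∈ x ∷ xs → R y z → f y ≡ f z) → Linked R (x ∷ xs) →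
      ∀ {y} → y ∈ x ∷ xs → f y ≡ f x
    constant-on-Linked f x xs       resp l       (here refl) = refl
    constant-on-Linked f x (z ∷ xs) resp (r ∷ l) (there y∈) = trans
      (constant-on-Linked f z xs (λ p q → resp (there p) (there q)) l y∈)
      (sym (resp (here refl) (there (here refl)) r))

-- The binary-expansion argument: positive distinct codes below 2^k bound the number of elements of level
-- < k by 2^k - 1, whereas a single element of level k forces at least 2^k elements.
module Dyadic {A : Set} (level code : A → ℕ) where

  record Blocks (xs : List A) : Set where
    field
      unique       : Unique xs
      positive     : ∀ {x} → x ∈ xs → 0 ℕ.< code x
      bounded      : ∀ {x} → x ∈ xs → code x ℕ.< 2 ^ suc (level x)
      injective    : ∀ {x y} → x ∈ xs → y ∈ xs → code x ≡ code y → x ≡ y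
      full         : ∀ {x} → x ∈ xs → 2 ^ level x ℕ.≤ length xs

  open Blocks

  length-<-2^ : ∀ {xs} → Blocks xs → ∀ k → (∀ {x} → x ∈ xs → level x ℕ.< k) → length xs ℕ.< 2 ^ k
  length-<-2^ {xs} b k below = ℕ.≤-<-trans
    (subst (length xs ℕ.≤_) (length-applyUpTo suc (ℕ.pred (2 ^ k))) (length-≤ code (unique b) ⊆ (injective b)))
    (ℕ.≤-reflexive (ℕ.suc-pred (2 ^ k)))
    where
    instance _ = ℕ.m^n≢0 2 k
    ⊆ : ∀ {x} → x ∈ xs → code x ∈ applyUpTo suc (ℕ.pred (2 ^ k))
    ⊆ {x} x∈ with code x | positive b x∈ | ℕ.<-≤-trans (bounded b x∈) (ℕ.^-monoʳ-≤ 2 (below x∈))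
    ... | suc c | _ | c< = ∈-applyUpTo⁺ suc (ℕ.<⇒≤pred c<)

  -- Peels off the top level: if one list has an element of level `k`, it has at least 2^k elements,
  -- while the other list lives below level `k` and has fewer.
  balanced⇒[] : ∀ {xs ys} → Blocks xs → Blocks ys → length xs ≡ length ys →
    (∀ {x y} → x ∈ xs → y ∈ ys → level x ≢ level y) →
    ∀ k → (∀ {x} → x ∈ xs → level x ℕ.< k) → (∀ {y} → y ∈ ys → level y ℕ.< k) → xs ≡ []
  balanced⇒[] {[]}    _ _ _ _ zero _    _ = refl
  balanced⇒[] {_ ∷ _} _ _ _ _ zero xs<k _ with () ← xs<k (here refl)
  balanced⇒[] {xs} {ys} bx by len disj (suc k) xs<k ys<k
    with any? (λ x → level x ℕ.≟ k) xs | any? (λ y → level y ℕ.≟ k) ys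
  ... | yes p | _ =
    let x , x∈ , eq = find p in
    ⊥-elim (ℕ.<-irrefl (sym len) (ℕ.<-≤-trans
      (length-<-2^ by k λ y∈ → ℕ.≤∧≢⇒< (ℕ.≤-pred (ys<k y∈)) λ eq′ → disj x∈ y∈ (trans eq (sym eq′)))
      (subst (λ l → 2 ^ l ℕ.≤ length xs) eq (full bx x∈))))
  ... | no _ | yes q =
    let y , y∈ , eq = find q in
    ⊥-elim (ℕ.<-irrefl len (ℕ.<-≤-trans
      (length-<-2^ bx k λ x∈ → ℕ.≤∧≢⇒< (ℕ.≤-pred (xs<k x∈)) λ eq′ → disj x∈ y∈ (trans eq′ (sym eq)))
      (subst (λ l → 2 ^ l ℕ.≤ length ys) eq (full by y∈))))
  ... | no ¬p | no ¬q = balanced⇒[] bx by len disj k (strict xs<k ¬p) (strict ys<k ¬q)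
    where
    strict : ∀ {zs} → (∀ {z} → z ∈ zs → level z ℕ.< suc k) → ¬ _ → ∀ {z} → z ∈ zs → level z ℕ.< k
    strict zs<k ¬r z∈ = ℕ.≤∧≢⇒< (ℕ.≤-pred (zs<k z∈)) λ eq → ¬r (lose z∈ eq)

-- The coloured subdivision

⌊k*2/2⌋ : ∀ k → ⌊ k ℕ.* 2 /2⌋ ≡ k
⌊k*2/2⌋ zero    = refl
⌊k*2/2⌋ (suc k) = cong suc (⌊k*2/2⌋ k)

odd-*2 : ∀ k → odd (k ℕ.* 2) ≡ false
odd-*2 zero    = refl
odd-*2 (suc k) = odd-*2 k

even⇒⌊/2⌋*2 : ∀ n → odd n ≡ false → ⌊ n /2⌋ ℕ.* 2 ≡ n
even⇒⌊/2⌋*2 0             _ = refl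
even⇒⌊/2⌋*2 (suc (suc n)) e = cong (λ k → suc (suc k)) (even⇒⌊/2⌋*2 n e)

⌊/2⌋-< : ∀ n k → n ℕ.< k ℕ.* 2 → ⌊ n /2⌋ ℕ.< k
⌊/2⌋-< 0             (suc k) _ = s≤s z≤n
⌊/2⌋-< 1             (suc k) _ = s≤s z≤n
⌊/2⌋-< (suc (suc n)) (suc k) (s≤s (s≤s n<)) = s≤s (⌊/2⌋-< n k n<)

mark? : ∀ c → Decidable (_≡ mark c)
mark? c original   = no λ ()
mark? c (letter _) = no λ ()
mark? c (mark d) with d ℕ.≟ c
... | yes refl = yes refl
... | no  d≢c  = no λ { refl → d≢c refl }

avoid : ∀ (x y z : Fin 4) → ∃[ c ] c ≢ x × c ≢ y × c ≢ z
avoid = toWitness {a? = Fin.all? λ x → Fin.all? λ y → Fin.all? λ z → Fin.any? λ c → ¬? (c Fin.≟ x) ×-dec ¬? (c Fin.≟ y) ×-dec ¬? (c Fin.≟ z)} tt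

module Subdivision (G : SimpleGraph) where

  size : Fin (m G) → ℕ
  size i = 2 ^ toℕ i

  size≢0 : ∀ i → NonZero (size i)
  size≢0 i = ℕ.m^n≢0 2 (toℕ i)

  sub : Fin (m G) → ℕ
  sub i = 4 ℕ.* size i ℕ.* 2

  V : Set
  V = SubV G sub

  Adj : V → V → Set
  Adj = SubAdj G sub

  colour : V → Colour
  colour (inj₁ _)       = original
  colour (inj₂ (i , j)) = colourAt (size i) {{size≢0 i}} (toℕ j)

  slot : ∀ i → Fin (sub i) → ℕ
  slot i j = ⌊ toℕ j /2⌋

  segment : ∀ i → Fin (sub i) → ℕ
  segment i j = _/_ (slot i j) (size i) {{size≢0 i}}

  segment<4 : ∀ i (j : Fin (sub i)) → segment i j ℕ.< 4
  segment<4 i j = ℕ.m<n*o⇒m/o<n (⌊/2⌋-< (toℕ j) (4 ℕ.* size i) (toℕ<n j))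
    where instance _ = size≢0 i

  segment-mono : ∀ i {j k : Fin (sub i)} → toℕ j ℕ.≤ toℕ k → segment i j ℕ.≤ segment i k
  segment-mono i j≤k = ℕ./-monoˡ-≤ (size i) {{size≢0 i}} (ℕ.⌊n/2⌋-mono j≤k)

  InSegment : ℕ → V → Set
  InSegment c (inj₁ _)       = ⊥
  InSegment c (inj₂ (i , j)) = segment i j ≡ c

  marked⇒InSegment : ∀ {c} v → colour v ≡ mark c → InSegment c v
  marked⇒InSegment (inj₂ (i , j)) eq with odd (toℕ j) | eq
  ... | false | refl = refl

  marker : ∀ i (c : Fin 4) → Fin (size i) → Fin (sub i)
  marker i c r = fromℕ< (ℕ.*-monoˡ-< 2 bound)
    where
    bound : toℕ r ℕ.+ toℕ c ℕ.* size i ℕ.< 4 ℕ.* size i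
    bound = ℕ.<-≤-trans (ℕ.+-monoˡ-< (toℕ c ℕ.* size i) (toℕ<n r)) (ℕ.*-monoˡ-≤ (size i) (toℕ<n c))

  toℕ-marker : ∀ i c r → toℕ (marker i c r) ≡ (toℕ r ℕ.+ toℕ c ℕ.* size i) ℕ.* 2
  toℕ-marker i c r = toℕ-fromℕ< _

  slot-marker : ∀ i c r → slot i (marker i c r) ≡ toℕ r ℕ.+ toℕ c ℕ.* size i
  slot-marker i c r = trans (cong ⌊_/2⌋ (toℕ-marker i c r)) (⌊k*2/2⌋ (toℕ r ℕ.+ toℕ c ℕ.* size i))

  segment-marker : ∀ i c r → segment i (marker i c r) ≡ toℕ c
  segment-marker i c r = begin
    slot i (marker i c r) / size i                        ≡⟨ cong (_/ size i) (slot-marker i c r) ⟩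
    (toℕ r ℕ.+ toℕ c ℕ.* size i) / size i               ≡⟨ ℕ.+-distrib-/-∣ʳ (toℕ r) (n∣m*n (toℕ c)) ⟩
    toℕ r / size i ℕ.+ toℕ c ℕ.* size i / size i        ≡⟨ cong₂ ℕ._+_ (ℕ.m<n⇒m/n≡0 (toℕ<n r)) (ℕ.m*n/n≡m (toℕ c) (size i)) ⟩
    toℕ c                                               ∎
    where
    open ≡-Reasoning
    instance _ = size≢0 i

  colour-marker : ∀ i c r → colour (inj₂ (i , marker i c r)) ≡ mark (toℕ c)
  colour-marker i c r = trans
    (cong (λ b → pick b (segment i (marker i c r)) (slot i (marker i c r))) (trans (cong odd (toℕ-marker i c r)) (odd-*2 (toℕ r ℕ.+ toℕ c ℕ.* size i))))
    (cong mark (segment-marker i c r))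

  marker-injective : ∀ i c {r s} → marker i c r ≡ marker i c s → r ≡ s
  marker-injective i c {r} {s} eq = toℕ-injective (ℕ.+-cancelʳ-≡ (toℕ c ℕ.* size i) (toℕ r) (toℕ s)
    (trans (sym (slot-marker i c r)) (trans (cong (slot i) eq) (slot-marker i c s))))

  -- Degree-two vertices and segments along a path

  data Up (i : Fin (m G)) (j : Fin (sub i)) : V → Set where
    up   : ∀ {k} → toℕ k ≡ suc (toℕ j) → Up i j (inj₂ (i , k))
    exit : suc (toℕ j) ≡ sub i → Up i j (inj₁ (proj₂ (edge G i)))

  data Down (i : Fin (m G)) (j : Fin (sub i)) : V → Set where
    down : ∀ {k} → suc (toℕ k) ≡ toℕ j → Down i j (inj₂ (i , k))
    exit : toℕ j ≡ 0 → Down i j (inj₁ (proj₁ (edge G i)))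

  Up-unique : ∀ {i j v w} → Up i j v → Up i j w → v ≡ w
  Up-unique {i} (up p) (up q) = cong (λ k → inj₂ (i , k)) (toℕ-injective (trans p (sym q)))
  Up-unique (up {k} p) (exit q) = ⊥-elim (ℕ.<-irrefl (trans p q) (toℕ<n k))
  Up-unique (exit q) (up {k} p) = ⊥-elim (ℕ.<-irrefl (trans p q) (toℕ<n k))
  Up-unique (exit _) (exit _) = refl

  Down-unique : ∀ {i j v w} → Down i j v → Down i j w → v ≡ w
  Down-unique {i} (down p) (down q) = cong (λ k → inj₂ (i , k)) (toℕ-injective (ℕ.suc-injective (trans p (sym q))))
  Down-unique (down p) (exit q) with () ← trans p q
  Down-unique (exit q) (down p) with () ← trans p q
  Down-unique (exit _) (exit _) = refl

  suc-last : ∀ i {j : Fin (sub i)} → toℕ j ≡ sub i ∸ 1 → suc (toℕ j) ≡ sub i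
  suc-last i {j} eq = trans (cong suc eq) (ℕ.suc-pred (sub i) {{ℕ.>-nonZero (ℕ.≤-<-trans z≤n (toℕ<n j))}})

  neighbour-Up⊎Down : ∀ {i j v} → Adj (inj₂ (i , j)) v → Up i j v ⊎ Down i j v
  neighbour-Up⊎Down (inj₁ (inner i j k eq))         = inj₁ (up eq)
  neighbour-Up⊎Down (inj₁ (last i _ v j e eq)) with refl ← cong proj₂ e = inj₁ (exit (suc-last i eq))
  neighbour-Up⊎Down (inj₂ (inner i k j eq))         = inj₂ (down (sym eq))
  neighbour-Up⊎Down (inj₂ (first i u _ j e eq)) with refl ← cong proj₁ e = inj₂ (exit eq)

  Adj-sym : ∀ {v w} → Adj v w → Adj w v
  Adj-sym (inj₁ a) = inj₂ a
  Adj-sym (inj₂ a) = inj₁ a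

  -- `Up` and `Down` each admit only one vertex, so two distinct neighbours must be one of each.
  distinct-neighbours : ∀ {i j p q} → p ≢ q → Adj p (inj₂ (i , j)) → Adj (inj₂ (i , j)) q →
    (Up i j p × Down i j q) ⊎ (Down i j p × Up i j q)
  distinct-neighbours p≢q pa aq with neighbour-Up⊎Down (Adj-sym pa) | neighbour-Up⊎Down aq
  ... | inj₁ x | inj₁ y = ⊥-elim (p≢q (Up-unique x y))
  ... | inj₁ x | inj₂ y = inj₁ (x , y)
  ... | inj₂ x | inj₁ y = inj₂ (x , y)
  ... | inj₂ x | inj₂ y = ⊥-elim (p≢q (Down-unique x y))

  -- On each edge the `c`-segment lies wholly in the list or misses it.
  SegmentClosed : ℕ → List V → Set
  SegmentClosed c vs = ∀ {i} {j k : Fin (sub i)} → segment i j ≡ c → segment i k ≡ c →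
    inj₂ (i , j) ∈ vs → inj₂ (i , k) ∈ vs

  module _ {c : ℕ} (x : V) (xs : List V) (linked : Linked Adj (x ∷ xs)) (unique : Unique (x ∷ xs))
    (x∉c : ¬ InSegment c x) (last∉c : ¬ InSegment c (lastOf x xs)) where

    private
      both : ∀ {i} {j : Fin (sub i)} → segment i j ≡ c → inj₂ (i , j) ∈ x ∷ xs →
        (∃[ v ] v ∈ x ∷ xs × Up i j v) × (∃[ v ] v ∈ x ∷ xs × Down i j v)
      both seg (here refl) = ⊥-elim (x∉c seg)
      both seg (there j∈) with interior-neighbours x xs linked unique j∈ (λ eq → last∉c (subst (InSegment c) eq seg))
      ... | p , q , p∈ , q∈ , p≢q , pa , aq with distinct-neighbours p≢q pa aq
      ...   | inj₁ (pu , qd) = (p , p∈ , pu) , (q , q∈ , qd)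
      ...   | inj₂ (pd , qu) = (q , q∈ , qu) , (p , p∈ , pd)

      step-up : ∀ {i} {j k : Fin (sub i)} → segment i j ≡ c → toℕ k ≡ suc (toℕ j) → inj₂ (i , j) ∈ x ∷ xs → inj₂ (i , k) ∈ x ∷ xs
      step-up seg eq j∈ with both seg j∈
      ... | (v , v∈ , uv) , _ = subst (_∈ x ∷ xs) (Up-unique uv (up eq)) v∈

      step-down : ∀ {i} {j k : Fin (sub i)} → segment i j ≡ c → suc (toℕ k) ≡ toℕ j → inj₂ (i , j) ∈ x ∷ xs → inj₂ (i , k) ∈ x ∷ xs
      step-down seg eq j∈ with both seg j∈
      ... | _ , (v , v∈ , dv) = subst (_∈ x ∷ xs) (Down-unique dv (down eq)) v∈

      go-up : ∀ d {i} {j k : Fin (sub i)} → d ℕ.+ toℕ j ≡ toℕ k → segment i j ≡ c → segment i k ≡ c → inj₂ (i , j) ∈ x ∷ xs → inj₂ (i , k) ∈ x ∷ xs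
      go-up zero {i} eq _ _ j∈ = subst (λ k → inj₂ (i , k) ∈ x ∷ xs) (toℕ-injective eq) j∈
      go-up (suc d) {i} {j} {k} eq segj segk j∈ =
        go-up d (trans (cong (d ℕ.+_) l≡) (trans (ℕ.+-suc d (toℕ j)) eq)) segl segk (step-up segj l≡ j∈)
        where
        j<k : suc (toℕ j) ℕ.≤ toℕ k
        j<k = subst (suc (toℕ j) ℕ.≤_) eq (s≤s (ℕ.m≤n+m (toℕ j) d))
        l : Fin (sub i)
        l = fromℕ< (ℕ.≤-<-trans j<k (toℕ<n k))
        l≡ : toℕ l ≡ suc (toℕ j)
        l≡ = toℕ-fromℕ< _
        -- Segment numbers are monotone in the position, so everything between two positions of
        -- segment `c` is in it too.
        segl : segment i l ≡ c
        segl = ℕ.≤-antisym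
          (subst (segment i l ℕ.≤_) segk (segment-mono i (subst (ℕ._≤ toℕ k) (sym l≡) j<k)))
          (subst (ℕ._≤ segment i l) segj (segment-mono i (subst (toℕ j ℕ.≤_) (sym l≡) (ℕ.n≤1+n _))))

      go-down : ∀ d {i} {j k : Fin (sub i)} → d ℕ.+ toℕ k ≡ toℕ j → segment i j ≡ c → segment i k ≡ c → inj₂ (i , j) ∈ x ∷ xs → inj₂ (i , k) ∈ x ∷ xs
      go-down zero {i} eq _ _ j∈ = subst (λ k → inj₂ (i , k) ∈ x ∷ xs) (sym (toℕ-injective eq)) j∈
      go-down (suc d) {i} {j} {k} eq segj segk j∈ = go-down d (sym l≡) segl segk (step-down segj (trans (cong suc l≡) eq) j∈)
        where
        l<j : d ℕ.+ toℕ k ℕ.< toℕ j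
        l<j = ℕ.≤-reflexive eq
        l : Fin (sub i)
        l = fromℕ< (ℕ.<-trans l<j (toℕ<n j))
        l≡ : toℕ l ≡ d ℕ.+ toℕ k
        l≡ = toℕ-fromℕ< _
        segl : segment i l ≡ c
        segl = ℕ.≤-antisym
          (subst (segment i l ℕ.≤_) segj (segment-mono i (subst (ℕ._≤ toℕ j) (sym l≡) (ℕ.<⇒≤ l<j))))
          (subst (ℕ._≤ segment i l) segk (segment-mono i (subst (toℕ k ℕ.≤_) (sym l≡) (ℕ.m≤n+m (toℕ k) d))))

    -- Both ends of the path avoid segment `c`, so each of its vertices on the path is interior and
    -- brings both neighbours along; this spreads through the whole segment.
    segment-closed : SegmentClosed c (x ∷ xs)
    segment-closed {i} {j} {k} segj segk j∈ with ℕ.≤-total (toℕ j) (toℕ k)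
    ... | inj₁ j≤k = go-up (toℕ k ∸ toℕ j) (ℕ.m∸n+n≡m j≤k) segj segk j∈
    ... | inj₂ k≤j = go-down (toℕ j ∸ toℕ k) (ℕ.m∸n+n≡m k≤j) segj segk j∈

  -- Counting the markers of one colour

  level code : V → ℕ
  level (inj₁ _)       = 0
  level (inj₂ (i , _)) = toℕ i
  code (inj₁ _)       = 0
  -- Codes on edge `i` lie between 2^i and 2^(i+1) - 1, so different edges have disjoint ranges; the
  -- second summand is the slot's index within its segment.
  code (inj₂ (i , j)) = size i ℕ.+ _%_ (slot i j) (size i) {{size≢0 i}}

  open Dyadic level code

  size≤code : ∀ i j → size i ℕ.≤ code (inj₂ (i , j))
  size≤code i j = ℕ.m≤m+n (size i) _

  code<2*size : ∀ i j → code (inj₂ (i , j)) ℕ.< 2 ^ suc (toℕ i)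
  code<2*size i j = ℕ.+-monoʳ-< (size i) (subst (slot i j % size i ℕ.<_) (sym (ℕ.+-identityʳ (size i))) (ℕ.m%n<n (slot i j) (size i)))
    where instance _ = size≢0 i

  code-edge-injective : ∀ i j i′ j′ → code (inj₂ (i , j)) ≡ code (inj₂ (i′ , j′)) → i ≡ i′
  code-edge-injective i j i′ j′ eq = toℕ-injective (ℕ.≤-antisym
    (ℕ.≮⇒≥ λ i′<i → above i′ j′ i j i′<i (sym eq)) (ℕ.≮⇒≥ λ i<i′ → above i j i′ j′ i<i′ eq))
    where
    above : ∀ i j i′ j′ → toℕ i ℕ.< toℕ i′ → code (inj₂ (i , j)) ≢ code (inj₂ (i′ , j′))
    above i j i′ j′ i<i′ eq = ℕ.<-irrefl eq
      (ℕ.<-≤-trans (code<2*size i j) (ℕ.≤-trans (ℕ.^-monoʳ-≤ 2 i<i′) (size≤code i′ j′)))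

  marked⇒even : ∀ {c} i j → colour (inj₂ (i , j)) ≡ mark c → odd (toℕ j) ≡ false
  marked⇒even i j eq with odd (toℕ j)
  ... | false = refl
  marked⇒even i j () | true

  code-position-injective : ∀ {c} i j k → colour (inj₂ (i , j)) ≡ mark c → colour (inj₂ (i , k)) ≡ mark c →
    code (inj₂ (i , j)) ≡ code (inj₂ (i , k)) → j ≡ k
  code-position-injective {c} i j k cj ck eq = toℕ-injective (begin
    toℕ j            ≡⟨ even⇒⌊/2⌋*2 (toℕ j) (marked⇒even i j cj) ⟨
    slot i j ℕ.* 2   ≡⟨ cong (ℕ._* 2) same-slot ⟩
    slot i k ℕ.* 2   ≡⟨ even⇒⌊/2⌋*2 (toℕ k) (marked⇒even i k ck) ⟩
    toℕ k            ∎)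
    where
    open ≡-Reasoning
    instance _ = size≢0 i
    same-slot : slot i j ≡ slot i k
    same-slot = begin
      slot i j
        ≡⟨ ℕ.m≡m%n+[m/n]*n (slot i j) (size i) ⟩
      slot i j % size i ℕ.+ segment i j ℕ.* size i
        ≡⟨ cong₂ (λ r q → r ℕ.+ q ℕ.* size i) (ℕ.+-cancelˡ-≡ (size i) _ _ eq)
             (trans (marked⇒InSegment (inj₂ (i , j)) cj) (sym (marked⇒InSegment (inj₂ (i , k)) ck))) ⟩
      slot i k % size i ℕ.+ segment i k ℕ.* size i
        ≡⟨ ℕ.m≡m%n+[m/n]*n (slot i k) (size i) ⟨
      slot i k ∎

  first-slot : ∀ i → Fin (size i)
  first-slot i = fromℕ< (ℕ.m^n>0 2 (toℕ i))

  module _ (c : Fin 4) where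

    Marked : V → Set
    Marked v = colour v ≡ mark (toℕ c)

    marked? : Decidable Marked
    marked? v = mark? (toℕ c) (colour v)

    marks : List V → List V
    marks = filter marked?

    all-markers : ∀ {vs} → SegmentClosed (toℕ c) vs → ∀ {i j} → inj₂ (i , j) ∈ marks vs →
      ∀ r → inj₂ (i , marker i c r) ∈ vs
    all-markers closed {i} {j} v∈ r with ∈-filter⁻ marked? v∈
    ... | v∈vs , eq = closed (marked⇒InSegment (inj₂ (i , j)) eq) (segment-marker i c r) v∈vs

    -- Closedness is what gives `full`: one `c`-marker of edge `i` in the list brings all 2^i of
    -- them.
    marks-blocks : ∀ {vs} → SegmentClosed (toℕ c) vs → Unique vs → Blocks (marks vs)
    marks-blocks {vs} closed uniq = record
      { unique    = Unique.filter⁺ marked? uniq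
      ; positive  = λ {v} v∈ → positive v (proj₂ (∈-filter⁻ marked? {xs = vs} v∈))
      ; bounded   = λ {v} v∈ → bounded v (proj₂ (∈-filter⁻ marked? {xs = vs} v∈))
      ; injective = λ {v} {w} v∈ w∈ → injective v w (proj₂ (∈-filter⁻ marked? {xs = vs} v∈)) (proj₂ (∈-filter⁻ marked? {xs = vs} w∈))
      ; full      = λ {v} v∈ → full v v∈ (proj₂ (∈-filter⁻ marked? {xs = vs} v∈))
      }
      where
      positive : ∀ v → Marked v → 0 ℕ.< code v
      positive (inj₂ (i , j)) _ = ℕ.<-≤-trans (ℕ.m^n>0 2 (toℕ i)) (size≤code i j)
      bounded : ∀ v → Marked v → code v ℕ.< 2 ^ suc (level v)
      bounded (inj₂ (i , j)) _ = code<2*size i j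
      injective : ∀ v w → Marked v → Marked w → code v ≡ code w → v ≡ w
      injective (inj₂ (i , j)) (inj₂ (i′ , k)) mv mw eq with refl ← code-edge-injective i j i′ k eq =
        cong (λ k → inj₂ (i , k)) (code-position-injective i j k mv mw eq)
      full : ∀ v → v ∈ marks vs → Marked v → 2 ^ level v ℕ.≤ length (marks vs)
      full (inj₂ (i , j)) v∈ _ = subst (ℕ._≤ length (marks vs)) (length-tabulate {n = size i} (λ r → r))
        (length-≤ (λ r → inj₂ (i , marker i c r)) (Unique.allFin⁺ (size i))
          (λ {r} _ → ∈-filter⁺ marked? (all-markers closed v∈ r) (colour-marker i c r))
          (λ { {r} {s} _ _ eq → marker-injective i c (inj₂-injectiveʳ eq) }))
        where
        inj₂-injectiveʳ : ∀ {j k} → _≡_ {A = V} (inj₂ (i , j)) (inj₂ (i , k)) → j ≡ k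
        inj₂-injectiveʳ refl = refl

    balanced⇒unmarked : ∀ {vs ws} → SegmentClosed (toℕ c) vs → SegmentClosed (toℕ c) ws →
      Unique vs → Unique ws → (∀ {v} → v ∈ vs → ¬ v ∈ ws) → length (marks vs) ≡ length (marks ws) →
      marks vs ≡ []
    balanced⇒unmarked {vs} {ws} cv cw uv uw disj len =
      balanced⇒[] (marks-blocks cv uv) (marks-blocks cw uw) len levels (m G)
        (λ {v} v∈ → below v (proj₂ (∈-filter⁻ marked? {xs = vs} v∈)))
        (λ {v} v∈ → below v (proj₂ (∈-filter⁻ marked? {xs = ws} v∈)))
      where
      below : ∀ v → Marked v → level v ℕ.< m G
      below (inj₂ (i , _)) _ = toℕ<n i
      levels : ∀ {x y} → x ∈ marks vs → y ∈ marks ws → level x ≢ level y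
      levels {x} {y} x∈ y∈ = levels′ x y x∈ y∈ (proj₂ (∈-filter⁻ marked? {xs = vs} x∈)) (proj₂ (∈-filter⁻ marked? {xs = ws} y∈))
        where
        levels′ : ∀ x y → x ∈ marks vs → y ∈ marks ws → Marked x → Marked y → level x ≢ level y
        levels′ (inj₂ (i , j)) (inj₂ (i′ , k)) x∈ y∈ _ _ eq with refl ← toℕ-injective eq =
          -- Marks of both lists on one edge would put its whole `c`-segment in both, in particular
          -- its first marker.
          disj (all-markers cv x∈ r) (all-markers cw y∈ r)
          where r = first-slot i

    -- Without the gates the subdivision falls apart into stars; owner is the centre of the star.
    gate : ∀ i → Fin (sub i)
    gate i = marker i c (first-slot i)

    side : ∀ {P : Set} → Fin (m G) → Dec P → Fin (n G)
    side i (yes _) = proj₁ (edge G i)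
    side i (no _)  = proj₂ (edge G i)

    owner : V → Fin (n G)
    owner (inj₁ v)       = v
    owner (inj₂ (i , j)) = side i (toℕ j ℕ.<? toℕ (gate i))

    owner-below : ∀ i j → toℕ j ℕ.< toℕ (gate i) → owner (inj₂ (i , j)) ≡ proj₁ (edge G i)
    owner-below i j j<g with toℕ j ℕ.<? toℕ (gate i)
    ... | yes _  = refl
    ... | no j≮g = ⊥-elim (j≮g j<g)

    owner-above : ∀ i j → toℕ (gate i) ℕ.≤ toℕ j → owner (inj₂ (i , j)) ≡ proj₂ (edge G i)
    owner-above i j g≤j with toℕ j ℕ.<? toℕ (gate i)
    ... | yes j<g = ⊥-elim (ℕ.<⇒≱ j<g g≤j)
    ... | no _    = refl

    unmarked⇒≢gate : ∀ i j → ¬ Marked (inj₂ (i , j)) → toℕ j ≢ toℕ (gate i)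
    unmarked⇒≢gate i j unmarked eq with refl ← toℕ-injective eq = unmarked (colour-marker i c (first-slot i))

    -- Along an edge the owner changes only at the gate, and the gate is marked.
    arc-owner : ∀ {v w} → ¬ Marked v → ¬ Marked w → SubArc G sub v w → owner v ≡ owner w
    -- Every edge contains a gate, so none is left undivided.
    arc-owner _ _ (direct i u v e eq) = ⊥-elim (ℕ.n≮0 (subst (toℕ (gate i) ℕ.<_) eq (toℕ<n (gate i))))
    arc-owner _ mw (first i u v j e eq) = sym (trans (owner-below i j j<g) (cong proj₁ e))
      where
      j<g : toℕ j ℕ.< toℕ (gate i)
      j<g = ℕ.≤∧≢⇒< (subst (ℕ._≤ toℕ (gate i)) (sym eq) z≤n) (unmarked⇒≢gate i j mw)
    arc-owner mv mw (inner i j k eq) with ℕ.<-cmp (toℕ j) (toℕ (gate i))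
    ... | tri< j<g _ _ = trans (owner-below i j j<g)
      (sym (owner-below i k (ℕ.≤∧≢⇒< (subst (ℕ._≤ toℕ (gate i)) (sym eq) j<g) (unmarked⇒≢gate i k mw))))
    ... | tri≈ _ j≡g _ = ⊥-elim (unmarked⇒≢gate i j mv j≡g)
    ... | tri> _ _ g<j = trans (owner-above i j (ℕ.<⇒≤ g<j))
      (sym (owner-above i k (ℕ.≤-trans (ℕ.<⇒≤ g<j) (subst (toℕ j ℕ.≤_) (sym eq) (ℕ.n≤1+n _)))))
    arc-owner _ _ (last i u v j e eq) = trans (owner-above i j g≤j) (cong proj₂ e)
      where
      g≤j : toℕ (gate i) ℕ.≤ toℕ j
      g≤j = ℕ.≤-pred (subst (toℕ (gate i) ℕ.<_) (sym (suc-last i eq)) (toℕ<n (gate i)))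

    -- The owner is constant along an unmarked path, and an original vertex owns itself.
    originals-equal : ∀ x xs → Linked Adj (x ∷ xs) → (∀ {v} → v ∈ x ∷ xs → ¬ Marked v) →
      ∀ {a b} → inj₁ a ∈ x ∷ xs → inj₁ b ∈ x ∷ xs → a ≡ b
    originals-equal x xs linked unmarked a∈ b∈ = trans (const a∈) (sym (const b∈))
      where
      const : ∀ {v} → v ∈ x ∷ xs → owner v ≡ owner x
      const = constant-on-Linked owner x xs (λ where
        v∈ w∈ (inj₁ a) → arc-owner (unmarked v∈) (unmarked w∈) a
        v∈ w∈ (inj₂ a) → sym (arc-owner (unmarked w∈) (unmarked v∈) a)) linked

  -- Paths without original vertices and the contradiction

  division-path : ∀ i j xs → Linked Adj (inj₂ (i , j) ∷ xs) → (∀ {a} → ¬ inj₁ a ∈ xs) →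
    ∃[ js ] inj₂ (i , j) ∷ xs ≡ map (λ k → inj₂ (i , k)) js
  division-path i j []            _       _   = j ∷ [] , refl
  division-path i j (inj₁ a ∷ xs) _       no₁ = ⊥-elim (no₁ (here refl))
  division-path i j (inj₂ _ ∷ xs) (inj₁ (inner _ _ k _) ∷ l) no₁ =
    let js , eq = division-path i k xs l (no₁ ∘ there) in j ∷ js , cong (inj₂ (i , j) ∷_) eq
  division-path i j (inj₂ _ ∷ xs) (inj₂ (inner _ k _ _) ∷ l) no₁ =
    let js , eq = division-path i k xs l (no₁ ∘ there) in j ∷ js , cong (inj₂ (i , j) ∷_) eq

  edge-neighbours : ∀ i {j k} → Adj (inj₂ (i , j)) (inj₂ (i , k)) → Neighbours (toℕ j) (toℕ k)
  edge-neighbours i (inj₁ (inner _ _ _ eq)) = inj₁ eq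
  edge-neighbours i (inj₂ (inner _ _ _ eq)) = inj₂ eq

  -- Only `inner` arcs occur, so the path stays on one edge; its positions form a walk to which
  -- `walk-not-anagram` applies.
  division-path-not-anagram : ∀ x xs ws → Linked Adj (x ∷ xs ++ ws) → Unique (x ∷ xs ++ ws) →
    (∀ {a} → ¬ inj₁ a ∈ x ∷ xs ++ ws) → ¬ (map colour (x ∷ xs) ↭ map colour ws)
  division-path-not-anagram (inj₁ a) xs ws _ _ no₁ _ = no₁ (here refl)
  division-path-not-anagram (inj₂ (i , j)) xs ws linked uniq no₁ perm
    with division-path i j (xs ++ ws) linked (no₁ ∘ there)
  ... | js , eq with map-++⁻ (λ k → inj₂ (i , k)) js {inj₂ (i , j) ∷ xs} (sym eq)
  ...   | us , vs , refl , equs , eqvs =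
    walk-not-anagram (size i) {{size≢0 i}} {map toℕ us} {map toℕ vs} (nonempty us equs)
      (subst₂ _↭_ (colours us equs) (colours vs eqvs) perm)
      (subst (Linked Neighbours) (map-++ toℕ us vs)
        (Linked.map⁺ (Linked.map (edge-neighbours i) (Linked.map⁻ (subst (Linked Adj) eq linked)))))
      (subst Unique (map-++ toℕ us vs) (Unique.map⁺ toℕ-injective (Unique.map⁻ (subst Unique eq uniq))))
    where
    nonempty : ∀ us {v vs} → map (λ k → inj₂ (i , k)) us ≡ v ∷ vs → map toℕ us ≢ []
    nonempty (_ ∷ _) _ ()
    colours : ∀ us {vs} → map (λ k → inj₂ (i , k)) us ≡ vs → map colour vs ≡ map (colourAt (size i) {{size≢0 i}}) (map toℕ us)
    colours us refl = trans (sym (map-∘ us)) (map-∘ us)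

  segmentOf : V → Fin 4
  -- An arbitrary default: original vertices lie in no segment.
  segmentOf (inj₁ _)       = zero
  segmentOf (inj₂ (i , j)) = fromℕ< (segment<4 i j)

  ≢segmentOf : ∀ {c} v → c ≢ segmentOf v → ¬ InSegment (toℕ c) v
  ≢segmentOf (inj₂ (i , j)) c≢ seg = c≢ (toℕ-injective (trans (sym seg) (sym (toℕ-fromℕ< _))))

  original-∈ : ∀ {vs} → original ∈ map colour vs → ∃[ a ] inj₁ a ∈ vs
  original-∈ o∈ with ∈-map⁻ colour o∈
  ... | inj₁ a , a∈ , _ = a , a∈
  ... | inj₂ (i , j) , _ , eq with odd (toℕ j) | eq
  ...   | true  | ()
  ...   | false | ()

  not-anagram : ∀ x xs y ys → Linked Adj (x ∷ xs ++ y ∷ ys) → Unique (x ∷ xs ++ y ∷ ys) →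
    ¬ (map colour (x ∷ xs) ↭ map colour (y ∷ ys))
  not-anagram x xs y ys linked uniq perm
    with avoid (segmentOf x) (segmentOf (lastOf x xs)) (segmentOf (lastOf y ys))
  ... | c , c≢x , c≢l , c≢y = division-path-not-anagram x xs (y ∷ ys) linked uniq no-original perm
    where
    V₁ = x ∷ xs
    V₂ = y ∷ ys

    l∉c : ¬ InSegment (toℕ c) (lastOf x xs)
    l∉c = ≢segmentOf (lastOf x xs) c≢l

    disjoint : ∀ {v} → v ∈ V₁ → ¬ v ∈ V₂
    disjoint = Unique-++-disjoint V₁ uniq

    uniq₂ : Unique (lastOf x xs ∷ V₂)
    uniq₂ = Unique-lastOf x xs uniq

    closed₁ : SegmentClosed (toℕ c) V₁
    closed₁ = segment-closed x xs (Linked-++ˡ V₁ linked) (Unique-++ˡ V₁ uniq) (≢segmentOf x c≢x) l∉c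

    closed₂ : SegmentClosed (toℕ c) V₂
    -- The first vertex of `V₂` may lie in segment `c`. Prepending the last vertex of `V₁` gives a
    -- path with both ends outside it, and the added vertex is then removed again.
    closed₂ {i} segj segk j∈ with segment-closed (lastOf x xs) V₂ (Linked-lastOf x xs linked) uniq₂
      l∉c (≢segmentOf (lastOf y ys) c≢y) segj segk (there j∈)
    ... | here eq   = ⊥-elim (l∉c (subst (InSegment (toℕ c)) eq segk))
    ... | there k∈ = k∈

    len : length (marks c V₁) ≡ length (marks c V₂)
    len = trans (sym (length-filter-map (mark? (toℕ c)) colour V₁))
      (trans (↭-length (filter-↭ (mark? (toℕ c)) perm)) (length-filter-map (mark? (toℕ c)) colour V₂))

    none₁ : marks c V₁ ≡ []
    none₁ = balanced⇒unmarked c closed₁ closed₂ (Unique-++ˡ V₁ uniq) (AllPairs.tail uniq₂) disjoint len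

    none₂ : marks c V₂ ≡ []
    none₂ with marks c V₂ | trans (sym len) (cong length none₁)
    ... | [] | _ = refl

    unmarked : ∀ {v} → v ∈ V₁ ++ V₂ → ¬ Marked c v
    unmarked v∈ mv with ∈-++⁻ V₁ v∈
    ... | inj₁ p with () ← subst (_ ∈_) none₁ (∈-filter⁺ (marked? c) p mv)
    ... | inj₂ p with () ← subst (_ ∈_) none₂ (∈-filter⁺ (marked? c) p mv)

    both : ∀ {a b} → inj₁ a ∈ V₁ → ¬ inj₁ b ∈ V₂
    both a∈ b∈ with refl ← originals-equal c x (xs ++ V₂) linked unmarked (∈-++⁺ˡ a∈) (∈-++⁺ʳ V₁ b∈) = disjoint a∈ b∈

    -- The permutation of colours turns an original vertex in one half into one in the other; `both`
    -- excludes that.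
    no-original : ∀ {a} → ¬ inj₁ a ∈ V₁ ++ V₂
    no-original a∈ with ∈-++⁻ V₁ a∈
    ... | inj₁ p = both p (proj₂ (original-∈ (∈-resp-↭ perm (∈-map⁺ colour p))))
    ... | inj₂ p = both (proj₂ (original-∈ {V₁} (∈-resp-↭ (↭-sym perm) (∈-map⁺ colour p)))) p

  colour-anagramFree : AnagramFree Adj colour
  colour-anagramFree ps (_ , uniq , linked) (W , P , W≢[] , P↭W , eq)
    with map-++⁻ colour ps {W} eq
  ... | []     , _      , _    , refl , _    = W≢[] refl
  ... | x ∷ xs , []     , _    , refl , refl with () ← ↭-length P↭W
  ... | x ∷ xs , y ∷ ys , refl , refl , refl = not-anagram x xs y ys linked uniq (↭-sym P↭W)

-- Encoding in fourteen colours

encode : Colour → Fin 14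
encode original   = join 1 13 (inj₁ zero)
encode (mark s)   = join 1 13 (inj₂ (join 4 9 (inj₁ (s ℕ.mod 4))))
encode (letter a) = join 1 13 (inj₂ (join 4 9 (inj₂ a)))

decode : Fin 14 → Colour
decode c with splitAt 1 c
... | inj₁ _ = original
... | inj₂ d with splitAt 4 d
...   | inj₁ s = mark (toℕ s)
...   | inj₂ a = letter a

-- encode reduces segment numbers mod 4, which loses nothing on the colours in use.
decode-encode-mark : ∀ s → s ℕ.< 4 → decode (encode (mark s)) ≡ mark s
decode-encode-mark s s<4 rewrite splitAt-join 4 9 (inj₁ (s ℕ.mod 4)) =
  cong mark (trans (toℕ-fromℕ< _) (ℕ.m<n⇒m%n≡m s<4))

decode-encode-letter : ∀ a → decode (encode (letter a)) ≡ letter a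
decode-encode-letter a rewrite splitAt-join 4 9 (inj₂ a) = refl

-- An anagram under `g ∘ c` is mapped by `g⁻¹` to an anagram under `c`, since permutations survive
-- `map`.
anagramFree-recolour : ∀ {V C D : Set} {Adj : V → V → Set} (c : V → C) (g : C → D) (g⁻¹ : D → C) →
  (∀ v → g⁻¹ (g (c v)) ≡ c v) → AnagramFree Adj c → AnagramFree Adj (g ∘ c)
anagramFree-recolour c g g⁻¹ inv free ps path (W , P , W≢[] , P↭W , eq) =
  free ps path (map g⁻¹ W , map g⁻¹ P , nonempty W W≢[] , map⁺ g⁻¹ P↭W , (begin
    map c ps                    ≡⟨ map-cong inv ps ⟨
    map (g⁻¹ ∘ g ∘ c) ps        ≡⟨ map-∘ ps ⟩
    map g⁻¹ (map (g ∘ c) ps)    ≡⟨ cong (map g⁻¹) eq ⟩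
    map g⁻¹ (W ++ P)            ≡⟨ map-++ g⁻¹ W P ⟩
    map g⁻¹ W ++ map g⁻¹ P      ∎))
  where
  open ≡-Reasoning
  nonempty : ∀ W → W ≢ [] → map g⁻¹ W ≢ []
  nonempty []      ne = λ _ → ne refl
  nonempty (_ ∷ _) ne = λ ()

subdivision-Φ≤14 : ∀ G → let open Subdivision G in PhiAtMost (SubAdj G sub) 14
subdivision-Φ≤14 G = encode ∘ colour , anagramFree-recolour colour encode decode decode-encode colour-anagramFree
  where
  open Subdivision G
  decode-encode : ∀ v → decode (encode (colour v)) ≡ colour v
  decode-encode (inj₁ _) = refl
  decode-encode (inj₂ (i , j)) with odd (toℕ j)
  ... | true  = decode-encode-letter (word (slot i j))
  ... | false = decode-encode-mark (segment i j) (segment<4 i j)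

-- The bound on division vertices and graphs with few edges

sub-bound : ∀ k i → i ℕ.≤ suc k → 4 ℕ.* 2 ^ i ℕ.* 2 ℕ.≤ 3 ℕ.* 2 ^ (2 ℕ.* suc (suc k) ∸ 1)
sub-bound k i i≤ = begin
  4 ℕ.* 2 ^ i ℕ.* 2                      ≤⟨ ℕ.*-monoˡ-≤ 2 (ℕ.*-monoʳ-≤ 4 (ℕ.^-monoʳ-≤ 2 i≤)) ⟩
  4 ℕ.* 2 ^ suc k ℕ.* 2                  ≡⟨ ring (2 ^ k) ⟩
  -- With `suc (suc k)` edges the target exponent is 2k + 3, so one factor 2 is split off and
  -- compared with the 3.
  2 ℕ.* 2 ^ (3 ℕ.+ k)                    ≤⟨ ℕ.*-mono-≤ (ℕ.n≤1+n 2) (ℕ.^-monoʳ-≤ 2 exponent) ⟩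
  3 ℕ.* 2 ^ (2 ℕ.* suc (suc k) ∸ 1)      ∎
  where
  open ℕ.≤-Reasoning
  ring : ∀ x → 4 ℕ.* (2 ℕ.* x) ℕ.* 2 ≡ 2 ℕ.* (2 ℕ.* (2 ℕ.* (2 ℕ.* x)))
  ring = ℕ-solve-∀
  exponent : 3 ℕ.+ k ℕ.≤ 2 ℕ.* suc (suc k) ∸ 1
  exponent = s≤s (ℕ.≤-trans (s≤s (s≤s (ℕ.≤-reflexive (sym (ℕ.+-identityʳ k))))) (ℕ.m≤n+m _ k))

-- With one edge the bound on division vertices is 6, too small for the eight of the general construction.
module SingleEdge (V : Set) (Adj : V → V → Set) (a b : V)
  (adj : ∀ {v w} → Adj v w → (v ≡ a × w ≡ b) ⊎ (v ≡ b × w ≡ a)) where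

  no-three : ∀ {v w x xs} → Linked Adj (v ∷ w ∷ x ∷ xs) → ¬ Unique (v ∷ w ∷ x ∷ xs)
  no-three (p ∷ q ∷ _) ((v≢w ∷ v≢x ∷ _) ∷ _) with adj p | adj q
  ... | inj₁ (refl , refl) | inj₁ (refl , refl) = v≢w refl
  ... | inj₁ (refl , refl) | inj₂ (refl , refl) = v≢x refl
  ... | inj₂ (refl , refl) | inj₁ (refl , refl) = v≢x refl
  ... | inj₂ (refl , refl) | inj₂ (refl , refl) = v≢w refl

  -- Paths have at most two vertices, so the only possible anagram is the edge itself with equally
  -- coloured ends.
  anagramFree : ∀ {C : Set} (c : V → C) → c a ≢ c b → AnagramFree Adj c
  anagramFree c ca≢cb ps (_ , uniq , linked) (W , P , W≢[] , P↭W , eq) with map-++⁻ c ps {W} eq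
  ... | []             , _          , _    , refl , _    = W≢[] refl
  ... | v ∷ vs         , []         , refl , refl , refl with () ← ↭-length P↭W
  ... | v ∷ []         , w ∷ x ∷ ws , refl , refl , refl with () ← ↭-length P↭W
  ... | v ∷ w ∷ []     , x ∷ ws     , refl , refl , refl = no-three linked uniq
  ... | v ∷ w ∷ x ∷ vs , _ ∷ _      , refl , refl , refl = no-three linked uniq
  ... | v ∷ []         , w ∷ []     , refl , refl , refl with ∈-resp-↭ P↭W (here refl) | adj (Linked.head linked)
  ...   | here cw≡cv | inj₁ (refl , refl) = ca≢cb (sym cw≡cv)
  ...   | here cw≡cv | inj₂ (refl , refl) = ca≢cb cw≡cv

single-edge-Φ≤14 : ∀ G → m G ≡ 1 → PhiAtMost (SubAdj G (λ _ → 0)) 14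
single-edge-Φ≤14 G@(record { m = 1 }) refl = colour , SingleEdge.anagramFree V (SubAdj G (λ _ → 0)) (inj₁ a) (inj₁ b) adj colour distinct
  where
  V = SubV G (λ _ → 0)
  a = proj₁ (edge G zero)
  b = proj₂ (edge G zero)
  colour : V → Fin 14
  colour (inj₁ v) with v Fin.≟ a
  ... | yes _ = # 0
  ... | no _  = # 1
  distinct : colour (inj₁ a) ≢ colour (inj₁ b)
  distinct with a Fin.≟ a | b Fin.≟ a
  ... | no a≢a | _       = λ _ → a≢a refl
  ... | yes _  | yes b≡a = λ _ → loopless G zero (sym b≡a)
  ... | yes _  | no _    = λ ()
  arc : ∀ {v w} → SubArc G (λ _ → 0) v w → v ≡ inj₁ a × w ≡ inj₁ b
  arc (direct zero u v e _) = cong (inj₁ ∘ proj₁) (sym e) , cong (inj₁ ∘ proj₂) (sym e)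
  adj : ∀ {v w} → SubAdj G (λ _ → 0) v w → (v ≡ inj₁ a × w ≡ inj₁ b) ⊎ (v ≡ inj₁ b × w ≡ inj₁ a)
  adj (inj₁ p) = inj₁ (arc p)
  adj (inj₂ p) = let x , y = arc p in inj₂ (y , x)

theorem5 : (G : SimpleGraph) →
    Σ (Fin (m G) → ℕ) (λ sub →
    (∀ i → sub i ≤ 3 * 2 ^ (2 * m G ∸ 1)) × PhiAtMost (SubAdj G sub) 14)
-- Here the exponent truncates to 0, but there is no edge to bound.
theorem5 G@(record { m = 0 })           = Subdivision.sub G , (λ ()) , subdivision-Φ≤14 G
theorem5 G@(record { m = 1 })           = (λ _ → 0) , (λ _ → z≤n) , single-edge-Φ≤14 G refl
theorem5 G@(record { m = suc (suc k) }) = Subdivision.sub G , (λ i → sub-bound k (toℕ i) (ℕ.≤-pred (toℕ<n i))) , subdivision-Φ≤14 G
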